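{- Let $\mathbb{F}_q$ be a finite field of odd characteristic and let $f\in \mathbb{F}_q[x]$ be a monic quadratic polynomial with critical point $\gamma$ and orbit type $(2,n)$ for some $n\geq 1$; write $b_i=f^i(\gamma)$. Let $g\in \mathbb{F}_q[x]$ be any monic, irreducible polynomial of even degree whose $f$-type starts with $ns$ (i.e. $g(b_1)$ is not a square in $\mathbb{F}_q$ and $g(b_2)$ is a square in $\mathbb{F}_q$). Then for every monic irreducible factor $H$ of $g(f^2(x))$ in $\mathbb{F}_q[x]$, the type of $H$ at $b_n$ is $s$, i.e. $H(b_n)$ is a square in $\mathbb{F}_q$.
   Context: For $k\ge 1$, $f^k$ denotes the $k$-fold composition of $f$ with itself, and $f^0(x)=x$. The critical point $\gamma$ of a monic quadratic $f$ is the unique $\gamma\in\mathbb{F}_q$ with $f'(\gamma)=0$. The orbit type of $f$ is the pair $(m,n)$ of minimal integers $m\geq 0$, $n\geq 1$ such that $f^m(\gamma)=f^{m+n}(\gamma)$; the post-critical orbit is $\{b_1,\dots,b_{m+n-1}\}$ with $b_i=f^i(\gamma)$. For a monic polynomial $g\in\mathbb{F}_q[x]$ and $\beta\in\mathbb{F}_q$, the type of $g$ at $\beta$ is $s$ if $g(\beta)$ is a square in $\mathbb{F}_q$ and $n$ otherwise. The $f$-type of $g$ is the string of length $m+n-1$ whose $k$-th entry is the type of $g$ at $b_k$. -}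

module Defs where

open import Level using (Level; suc; _⊔_)
open import Data.Nat as ℕ using (ℕ; zero) renaming (suc to 1+)
open import Data.List using (List; []; _∷_; foldr; length)
open import Data.List.Membership.Propositional using (_∈_)
open import Data.Product using (Σ; ∃; _×_; _,_)
open import Relation.Binary.PropositionalEquality using (_≡_)
open import Relation.Nullary using (¬_; Dec)
open import Algebra.Structures using (IsCommutativeRing)
open import Data.Sum using (_⊎_)

record FiniteField (c : Level) : Set (Level.suc c) where
  infixl 7 _*_
  infixl 6 _+_
  field
    Carrier : Set c
    _+_ _*_ : Carrier → Carrier → Carrier
    -_      : Carrier → Carrier
    0# 1#   : Carrier
    isCommutativeRing : IsCommutativeRing _≡_ _+_ _*_ -_ 0# 1#
    0≢1     : ¬ (0# ≡ 1#)
    inverse : ∀ x → ¬ (x ≡ 0#) → Σ Carrier (λ y → x * y ≡ 1#)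
    _≟_     : (x y : Carrier) → Dec (x ≡ y)
    elements : List Carrier
    complete : ∀ x → x ∈ elements

module FieldDefs {c} (F : FiniteField c) where
  open FiniteField F

  OddCharacteristic : Set c
  OddCharacteristic = ¬ ((1# + 1#) ≡ 0#)

  IsSquare : Carrier → Set c
  IsSquare a = ∃ λ y → y * y ≡ a

  -- Polynomials: coefficient lists, constant term first
  -- (trailing zero coefficients allowed; equality is coefficientwise)

  Poly : Set c
  Poly = List Carrier

  coeff : Poly → ℕ → Carrier
  coeff []       _      = 0#
  coeff (a ∷ p)  zero   = a
  coeff (a ∷ p)  (1+ i) = coeff p i

  infix 4 _≈P_
  _≈P_ : Poly → Poly → Set c
  p ≈P q = ∀ i → coeff p i ≡ coeff q i

  infixl 6 _+P_
  _+P_ : Poly → Poly → Poly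
  []      +P q       = q
  (a ∷ p) +P []      = a ∷ p
  (a ∷ p) +P (b ∷ q) = (a + b) ∷ (p +P q)

  scale : Carrier → Poly → Poly
  scale a []      = []
  scale a (b ∷ p) = (a * b) ∷ scale a p

  infixl 7 _*P_
  _*P_ : Poly → Poly → Poly
  []      *P q = []
  (a ∷ p) *P q = scale a q +P (0# ∷ (p *P q))

  eval : Poly → Carrier → Carrier
  eval []      x = 0#
  eval (a ∷ p) x = a + x * eval p x

  compose : Poly → Poly → Poly
  compose []      q = []
  compose (a ∷ p) q = (a ∷ []) +P (q *P compose p q)

  deriv : Poly → Poly
  deriv []      = []
  deriv (a ∷ p) = go 1# p
    where
      go : Carrier → Poly → Poly
      go k []      = []
      go k (b ∷ r) = (k * b) ∷ go (k + 1#) r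

  normalize : Poly → Poly
  normalize []      = []
  normalize (a ∷ p) with normalize p
  ... | b ∷ r = a ∷ b ∷ r
  ... | []    with a ≟ 0#
  ...   | Relation.Nullary.yes _ = []
  ...   | Relation.Nullary.no  _ = a ∷ []

  -- degree (the zero polynomial gets degree 0 by convention;
  -- it is never monic, so this does not matter below)
  degree : Poly → ℕ
  degree p = length (normalize p) ℕ.∸ 1

  leading : Poly → Carrier
  leading p = coeff p (degree p)

  Monic : Poly → Set c
  Monic p = leading p ≡ 1#

  infix 4 _∣P_
  _∣P_ : Poly → Poly → Set c
  p ∣P q = ∃ λ r → p *P r ≈P q

  Irreducible : Poly → Set c
  Irreducible p = (1 ℕ.≤ degree p) ×
    (∀ a b → a *P b ≈P p → degree a ≡ 0 ⊎ degree b ≡ 0)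

  iter : Poly → ℕ → Carrier → Carrier
  iter f zero   x = x
  iter f (1+ k) x = eval f (iter f k x)

  MonicQuadratic : Poly → Set c
  MonicQuadratic f = Monic f × degree f ≡ 2

  CriticalPoint : Poly → Carrier → Set c
  CriticalPoint f γ = eval (deriv f) γ ≡ 0#

  -- orbit type of f (with critical point γ) is (m , n):
  -- (m , n) is the lexicographically minimal pair with m ≥ 0, n ≥ 1 and
  -- f^m(γ) = f^(m+n)(γ)
  OrbitType : Poly → Carrier → ℕ → ℕ → Set c
  OrbitType f γ m n =
    (1 ℕ.≤ n) ×
    (iter f m γ ≡ iter f (m ℕ.+ n) γ) ×
    (∀ m' n' → m' ℕ.< m → 1 ℕ.≤ n' → ¬ (iter f m' γ ≡ iter f (m' ℕ.+ n') γ)) ×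
    (∀ n' → 1 ℕ.≤ n' → n' ℕ.< n → ¬ (iter f m γ ≡ iter f (m ℕ.+ n') γ))

{-# OPTIONS --safe #-}
-- Let K = F[x]/(g), with α the class of x, and L = F[x]/(H), in which α is sent to f(f(x)). If S² ≡ a - x modulo a
-- monic h, Thue's lemma gives W ≡ S V with W² - (a - x) V² equal to a scalar multiple of h; comparing leading
-- coefficients shows that the scalar is a square, so h(a) is a square. This and its variants translate the
-- hypotheses on g: ν = α - b₁ is not a square in K, while all scalars and b₂ - α are. As the squares have index
-- two in K, every element of K becomes a square in L, where ν = (f(x) - γ)².
-- Write δ = x - γ, e = b₁ - γ, b₂ - α = t² and b = b_n - γ. Preperiodicity gives b² = - 2e, and
-- (δ² + e)² = ν = e² - t². For the right sign of t, 2(t - e) is a square s² in K, and δ² - s δ + t = 0 for one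
-- sign of s. The norm of z = b - δ is then (b - s)²/2 = n² with n in K, so (z + n)² = z (tr z + 2n); as tr z + 2n
-- is a square in L, so is z = b_n - x, and hence H(b_n) is a square.

module Submission where

open import Defs
open import Level using (Level; _⊔_)
open import Algebra.Bundles using (AbelianGroup; CommutativeRing)
open import Algebra.Structures using (IsAbelianGroup)
open import Algebra.Solver.Ring.AlmostCommutativeRing using (fromCommutativeRing; _-Raw-AlmostCommutative⟶_)
import Algebra.Properties.CommutativeSemigroup as CommutativeSemigroupProperties
import Algebra.Properties.Ring as RingProperties
import Algebra.Properties.Semiring.Mult.TCOptimised as Multiples
import Algebra.Solver.Ring as RingSolver
open import Data.Bool using (Bool; true; false)
open import Data.Empty using (⊥-elim)
open import Data.Fin using (Fin; toℕ)
import Data.Fin.Properties as Fin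
open import Data.Integer as ℤ using (ℤ; -[1+_])
import Data.Integer.Properties as ℤ
open import Data.List using (List; []; _∷_; length; lookup; cartesianProductWith)
open import Data.List.Membership.Propositional using (_∈_)
open import Data.List.Membership.Propositional.Properties using (∈-cartesianProductWith⁺)
open import Data.List.Relation.Unary.Any as Any using (Any; here; there; index)
open import Data.List.Relation.Unary.Any.Properties using (lookup-index)
open import Data.Maybe using (Maybe; just; nothing)
open import Data.Nat as ℕ using (ℕ; zero; suc; _≤_; _<_; z≤n; s≤s; _*_)
import Data.Nat.Properties as ℕ
open import Data.Product using (∃; _×_; _,_; proj₁; proj₂)
open import Data.Sum using (_⊎_; inj₁; inj₂; fromInj₁; fromInj₂)
open import Function using (_∘_; id)
open import Relation.Binary.PropositionalEquality as ≡ using (_≡_)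
open import Relation.Nullary using (¬_; Dec; yes; no; contradiction)
import Relation.Binary.Reasoning.Setoid as SetoidReasoning

-- For irreducible monic h, h(a) is the norm of a - x from F[x]/(h), and in a finite field an
-- element is a square exactly when its norm is. Thue's lemma stands in for this theory but yields
-- one direction only, from square classes to square values. The way back rests on the single
-- nonsquare value g(b₁): were b₂ - α not a square in K, then ν (b₂ - α) would be one, and the
-- variant of Thue's argument with two roots would make g(b₁) g(b₂) a square. The same trick shows
-- that scalars are squares; there the even degree of g enters. In the tower, trace and norm are
-- formal: they belong to the polynomial X² - s X + t, and whether δ generates a quadratic extension
-- is never decided. Given b² = - 2e and s² = 2(t - e), both b² - s b + t and (b - s)²/2 equal t -
-- 2e - b s; the root n then needs a square root of the scalar 1/2 in K. The parity of deg H is not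
-- determined, so Thue's lemma is applied in both parities. In odd degree the scalar is minus a
-- square times the leading coefficient of a - x, hence a square: this is why a - x is used and not
-- x - a.

module IntegerSolver {c ℓ} (R : CommutativeRing c ℓ) where
  open CommutativeRing R renaming (_*_ to _·_)
  open RingProperties ring
  open CommutativeSemigroupProperties +-commutativeSemigroup using (interchange)
  open Multiples semiring using (1+×; ×-homo-+; ×1-homo-*) renaming (_×_ to _×′_)
  open SetoidReasoning setoid
  open import Data.Integer using (+_)

  -- Integers have decidable equality, which the ring need not have, so a solver with integer
  -- coefficients can cancel in every commutative ring. With this version of multiples `1 ×′ 1#`
  -- computes to `1#`, so `:1` denotes `1#` itself.
  embed : ℤ → Carrier
  embed (+ n)    = n ×′ 1#
  embed -[1+ n ] = - (suc n ×′ 1#)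

  embed-⊖ : ∀ m n → embed (m ℤ.⊖ n) ≈ m ×′ 1# - n ×′ 1#
  embed-⊖ zero    zero    = sym (-‿inverseʳ 0#)
  embed-⊖ zero    (suc n) = sym (+-identityˡ _)
  embed-⊖ (suc m) zero    = sym (trans (+-congˡ -0#≈0#) (+-identityʳ _))
  embed-⊖ (suc m) (suc n) = begin
    embed (suc m ℤ.⊖ suc n)               ≡⟨ ≡.cong embed (ℤ.[1+m]⊖[1+n]≡m⊖n m n) ⟩
    embed (m ℤ.⊖ n)                       ≈⟨ embed-⊖ m n ⟩
    m ×′ 1# - n ×′ 1#                     ≈⟨ +-identityˡ _ ⟨
    0# + (m ×′ 1# - n ×′ 1#)              ≈⟨ +-congʳ (-‿inverseʳ 1#) ⟨
    (1# - 1#) + (m ×′ 1# - n ×′ 1#)       ≈⟨ interchange _ _ _ _ ⟩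
    (1# + m ×′ 1#) + (- 1# - n ×′ 1#)     ≈⟨ +-cong (sym (1+× m 1#)) (-‿+-comm _ _) ⟩
    suc m ×′ 1# - (1# + n ×′ 1#)          ≈⟨ +-congˡ (-‿cong (1+× n 1#)) ⟨
    suc m ×′ 1# - suc n ×′ 1#             ∎

  embed-neg : ∀ i → embed (ℤ.- i) ≈ - embed i
  embed-neg (+ zero)   = sym -0#≈0#
  embed-neg (+ suc n)  = refl
  embed-neg -[1+ n ]   = sym (-‿involutive _)

  embed-+ : ∀ i j → embed (i ℤ.+ j) ≈ embed i + embed j
  embed-+ (+ m)    (+ n)    = ×-homo-+ 1# m n
  embed-+ (+ m)    -[1+ n ] = embed-⊖ m (suc n)
  embed-+ -[1+ m ] (+ n)    = trans (embed-⊖ n (suc m)) (+-comm _ _)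
  embed-+ -[1+ m ] -[1+ n ] = begin
    - (suc (suc (m ℕ.+ n)) ×′ 1#)       ≡⟨ ≡.cong (λ k → - (suc k ×′ 1#)) (ℕ.+-suc m n) ⟨
    - ((suc m ℕ.+ suc n) ×′ 1#)         ≈⟨ -‿cong (×-homo-+ 1# (suc m) (suc n)) ⟩
    - (suc m ×′ 1# + suc n ×′ 1#)       ≈⟨ -‿+-comm _ _ ⟨
    - (suc m ×′ 1#) - suc n ×′ 1#       ∎

  embed-*-pos : ∀ m j → embed (+ m ℤ.* j) ≈ embed (+ m) · embed j
  embed-*-pos m (+ n) = begin
    embed (+ m ℤ.* + n)      ≡⟨ ≡.cong embed (ℤ.pos-* m n) ⟨
    (m ℕ.* n) ×′ 1#          ≈⟨ ×1-homo-* m n ⟩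
    m ×′ 1# · n ×′ 1#        ∎
  embed-*-pos m -[1+ n ] = begin
    embed (+ m ℤ.* -[1+ n ])            ≡⟨ ≡.cong embed (ℤ.neg-distribʳ-* (+ m) (+ suc n)) ⟨
    embed (ℤ.- (+ m ℤ.* + suc n))       ≈⟨ embed-neg (+ m ℤ.* + suc n) ⟩
    - embed (+ m ℤ.* + suc n)           ≡⟨ ≡.cong (λ i → - embed i) (ℤ.pos-* m (suc n)) ⟨
    - ((m ℕ.* suc n) ×′ 1#)             ≈⟨ -‿cong (×1-homo-* m (suc n)) ⟩
    - (embed (+ m) · embed (+ suc n))   ≈⟨ -‿distribʳ-* _ _ ⟩
    embed (+ m) · embed -[1+ n ]        ∎

  embed-* : ∀ i j → embed (i ℤ.* j) ≈ embed i · embed j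
  embed-* (+ m)    j = embed-*-pos m j
  embed-* -[1+ m ] j = begin
    embed (-[1+ m ] ℤ.* j)            ≡⟨ ≡.cong embed (ℤ.neg-distribˡ-* (+ suc m) j) ⟨
    embed (ℤ.- (+ suc m ℤ.* j))       ≈⟨ embed-neg (+ suc m ℤ.* j) ⟩
    - embed (+ suc m ℤ.* j)           ≈⟨ -‿cong (embed-*-pos (suc m) j) ⟩
    - (embed (+ suc m) · embed j)     ≈⟨ -‿distribˡ-* _ _ ⟩
    embed -[1+ m ] · embed j          ∎

  embedding : CommutativeRing.rawRing ℤ.+-*-commutativeRing -Raw-AlmostCommutative⟶ fromCommutativeRing R
  embedding = record
    { ⟦_⟧    = embed
    ; +-homo = embed-+
    ; *-homo = embed-*
    ; -‿homo = embed-neg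
    ; 0-homo = refl
    ; 1-homo = refl
    }

  embed-≟ : ∀ i j → Maybe (embed i ≈ embed j)
  embed-≟ i j with i ℤ.≟ j
  ... | yes i≡j = just (reflexive (≡.cong embed i≡j))
  ... | no  _   = nothing

  open RingSolver (CommutativeRing.rawRing ℤ.+-*-commutativeRing) (fromCommutativeRing R) embedding embed-≟ public
    using (Polynomial; con; solve; _:=_; _:+_; _:*_; _:-_; :-_)

  :0 :1 : ∀ {n} → Polynomial n
  :0 = con (+ 0)
  :1 = con (+ 1)

-- Squares and identities in commutative rings; quotients by a principal ideal.

module RingLemmas {c ℓ} (R : CommutativeRing c ℓ) where
  open CommutativeRing R renaming (_*_ to _·_)
  open RingProperties ring
  open IntegerSolver R

  Square : Carrier → Set (c ⊔ ℓ)
  Square a = ∃ λ x → x · x ≈ a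

  Domain : Set (c ⊔ ℓ)
  Domain = ∀ x y → x · y ≈ 0# → x ≈ 0# ⊎ y ≈ 0#

  -- The field axiom as a decision, the form in which Euclid's algorithm delivers it for residue
  -- rings.
  ZeroOrUnit : Set (c ⊔ ℓ)
  ZeroOrUnit = ∀ x → x ≈ 0# ⊎ ∃ λ y → x · y ≈ 1#

  square-resp : ∀ {a b} → a ≈ b → Square a → Square b
  square-resp a≈b (x , xx≈a) = x , trans xx≈a a≈b

  interchange-squares : ∀ x y → (x · y) · (x · y) ≈ (x · x) · (y · y)
  interchange-squares = solve 2 (λ x y → (x :* y) :* (x :* y) := (x :* x) :* (y :* y)) refl

  square-* : ∀ {a b} → Square a → Square b → Square (a · b)
  square-* (x , p) (y , q) = x · y , trans (interchange-squares x y) (*-cong p q)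

  diff≈0⇒≈ : ∀ {x y} → x - y ≈ 0# → x ≈ y
  diff≈0⇒≈ {x} {y} p = trans (solve 2 (λ x y → x := (x :- y) :+ y) refl x y) (trans (+-congʳ p) (+-identityˡ y))

  ≈⇒diff≈0 : ∀ {x y} → x ≈ y → x - y ≈ 0#
  ≈⇒diff≈0 {x} {y} p = trans (+-congʳ p) (-‿inverseʳ y)

  sum≈0⇒≈- : ∀ {x y} → x + y ≈ 0# → x ≈ - y
  sum≈0⇒≈- {x} {y} p = +-inverseˡ-unique x y p

  -- The solver proves identities only. A hypothesis `e ≈ 0#` therefore enters an identity as a
  -- summand `x · e`, which is stripped off afterwards by this lemma.
  +zeros : ∀ {a x e} → e ≈ 0# → a + x · e ≈ a
  +zeros {a} {x} p = trans (+-congˡ (trans (*-congˡ p) (zeroʳ x))) (+-identityʳ a)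

  zero-or-unit⇒domain : ZeroOrUnit → Domain
  zero-or-unit⇒domain zu x y xy≈0 with zu x
  ... | inj₁ x≈0 = inj₁ x≈0
  ... | inj₂ (x⁻¹ , inv) = inj₂ (trans (sym (*-identityˡ y)) (trans (*-congʳ (sym inv))
      (trans (solve 3 (λ x z y → (x :* z) :* y := z :* (x :* y)) refl x x⁻¹ y) (trans (*-congˡ xy≈0) (zeroʳ x⁻¹)))))

  cancelˡ : Domain → ∀ {l x y} → ¬ (l ≈ 0#) → l · x ≈ l · y → x ≈ y
  cancelˡ dom {l} {x} {y} l≉0 p with dom l (x - y)
    (trans (solve 3 (λ l x y → l :* (x :- y) := l :* x :- l :* y) refl l x y) (≈⇒diff≈0 p))
  ... | inj₁ z = contradiction z l≉0
  ... | inj₂ z = diff≈0⇒≈ z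

  -- Proved over an abstract ring, where no operation on lists can unfold; this and the identities
  -- below are instantiated later, mostly with polynomials.
  division-step : ∀ a x r q h l → a + x · (r + q · h) ≈ ((a + x · r) - l · h) + (x · q + l) · h
  division-step = solve 6 (λ a x r q h l → a :+ x :* (r :+ q :* h) := ((a :+ x :* r) :- l :* h) :+ (x :* q :+ l) :* h) refl

  bezout-step : ∀ u v r q p → u · r + v · p ≈ (v - u · q) · p + u · (r + q · p)
  bezout-step = solve 5 (λ u v r q p → u :* r :+ v :* p := (v :- u :* q) :* p :+ u :* (r :+ q :* p)) refl

  cofactor-step : ∀ a q b d → a · d + q · (b · d) ≈ (a + q · b) · d
  cofactor-step = solve 4 (λ a q b d → a :* d :+ q :* (b :* d) := (a :+ q :* b) :* d) refl

  inverse-modulo : ∀ p u e v h → p · (u · e) ≈ (u · p + v · h) · e + (- (v · e)) · h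
  inverse-modulo = solve 5 (λ p u e v h → p :* (u :* e) := (u :* p :+ v :* h) :* e :+ (:- (v :* e)) :* h) refl

  synthetic-division-step : ∀ b x a v q → b + x · (v + (a - x) · q) ≈ (b + a · v) + (a - x) · (x · q - v)
  synthetic-division-step = solve 5 (λ b x a v q → b :+ x :* (v :+ (a :- x) :* q) := (b :+ a :* v) :+ (a :- x) :* (x :* q :- v)) refl

  square-of-product : ∀ l w → (l · w) · (l · w) ≈ l · (l · (w · w))
  square-of-product = solve 2 (λ l w → (l :* w) :* (l :* w) := l :* (l :* (w :* w))) refl

  scaled-square-of-product : ∀ b l v → b · ((l · v) · (l · v)) ≈ l · ((l · b) · (v · v))
  scaled-square-of-product = solve 3 (λ b l v → b :* ((l :* v) :* (l :* v)) := l :* ((l :* b) :* (v :* v))) refl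

  factor-out : ∀ s v a w → s · (v - a · w) ≈ s · v - a · (s · w)
  factor-out = solve 4 (λ s v a w → s :* (v :- a :* w) := s :* v :- a :* (s :* w)) refl

  minus-factor : ∀ q h l → (0# + q · h) - l · h ≈ 0# + (q - l) · h
  minus-factor = solve 3 (λ q h l → (:0 :+ q :* h) :- l :* h := :0 :+ (q :- l) :* h) refl

  completed-square : ∀ a₀ a₁ x γ → a₀ + x · (a₁ + x · 1#) ≈ ((x - γ) · (x - γ) + (a₀ + γ · (a₁ + γ · 1#))) + (x - γ) · (a₁ + (1# + 1#) · γ)
  completed-square = solve 4 (λ a₀ a₁ x γ → a₀ :+ x :* (a₁ :+ x :* :1)
    := ((x :- γ) :* (x :- γ) :+ (a₀ :+ γ :* (a₁ :+ γ :* :1))) :+ (x :- γ) :* (a₁ :+ (:1 :+ :1) :* γ)) refl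

  gather-factor : ∀ l m r → ((l · m) · r) · m ≈ (m · m) · (l · r)
  gather-factor = solve 3 (λ l m r → ((l :* m) :* r) :* m := (m :* m) :* (l :* r)) refl

  negated-difference : ∀ a x → x - a ≈ (a - x) · (- 1#)
  negated-difference = solve 2 (λ a x → x :- a := (a :- x) :* (:- :1)) refl

  difference-in-sum : ∀ x a b → ((x + a) - b) ≈ x + (a - b)
  difference-in-sum = solve 3 (λ x a b → (x :+ a) :- b := x :+ (a :- b)) refl

  sum-cancels : ∀ y a x → y - ((y + a) - x) ≈ x - a
  sum-cancels = solve 3 (λ y a x → y :- ((y :+ a) :- x) := x :- a) refl

  shift-difference : ∀ b x γ → b - (x - γ) ≈ ((b + γ) - x) · 1#
  shift-difference = solve 3 (λ b x γ → b :- (x :- γ) := ((b :+ γ) :- x) :* :1) refl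

  restore : ∀ x γ → (x - γ) + γ ≈ x
  restore = solve 2 (λ x γ → (x :- γ) :+ γ := x) refl

  drop-constant : ∀ x a → (x + a) - a ≈ x
  drop-constant = solve 2 (λ x a → (x :+ a) :- a := x) refl

  double-as-difference : ∀ x a b → x + (1# + 1#) · (a - b) ≈ (a - b) - (- ((x + a) - b))
  double-as-difference = solve 3 (λ x a b → x :+ (:1 :+ :1) :* (a :- b) := (a :- b) :- (:- ((x :+ a) :- b))) refl

  interchange-scalar : ∀ x y e → (x · y) · (e · e) ≈ (x · e) · (y · e)
  interchange-scalar = solve 3 (λ x y e → (x :* y) :* (e :* e) := (x :* e) :* (y :* e)) refl

  regroup : ∀ a e b d → a · ((b · e) · d) ≈ (a · e) · (b · d)
  regroup = solve 4 (λ a e b d → a :* ((b :* e) :* d) := (a :* e) :* (b :* d)) refl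

  square-roots : Domain → ∀ {x y} → x · x ≈ y · y → x ≈ y ⊎ x ≈ - y
  square-roots dom {x} {y} p with dom (x - y) (x + y)
      (trans (solve 2 (λ x y → (x :- y) :* (x :+ y) := x :* x :- y :* y) refl x y) (≈⇒diff≈0 p))
  ... | inj₁ q = inj₁ (diff≈0⇒≈ q)
  ... | inj₂ q = inj₂ (sum≈0⇒≈- q)

  square-zero : Domain → ∀ {x} → x · x ≈ 0# → x ≈ 0#
  square-zero dom {x} p with dom x x p
  ... | inj₁ q = q
  ... | inj₂ q = q

  square-quotient : ∀ {x y z y⁻¹} → y · y⁻¹ ≈ 1# → x · (y · y) ≈ z · z → Square x
  square-quotient {x} {y} {z} {y⁻¹} inv p = z · y⁻¹ , (begin
      (z · y⁻¹) · (z · y⁻¹)          ≈⟨ interchange-squares z y⁻¹ ⟩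
      (z · z) · (y⁻¹ · y⁻¹)          ≈⟨ *-congʳ p ⟨
      (x · (y · y)) · (y⁻¹ · y⁻¹)    ≈⟨ solve 3 (λ x y w → (x :* (y :* y)) :* (w :* w) := x :* ((y :* w) :* (y :* w))) refl x y y⁻¹ ⟩
      x · ((y · y⁻¹) · (y · y⁻¹))    ≈⟨ *-congˡ (*-cong inv inv) ⟩
      x · (1# · 1#)                  ≈⟨ solve 1 (λ x → x :* (:1 :* :1) := x) refl x ⟩
      x                              ∎)
    where open SetoidReasoning setoid

module QuotientRing {c ℓ} (R : CommutativeRing c ℓ) (h : CommutativeRing.Carrier R) where
  open CommutativeRing R renaming (_*_ to _·_)
  open IntegerSolver R

  infix 4 _∼_
  -- The quotient keeps the carrier and coarsens the equality, so residue classes are handled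
  -- through their representatives. As a record type, `a ∼ b` lets unification recover `a` and `b`.
  record _∼_ (a b : Carrier) : Set (c ⊔ ℓ) where
    constructor modulo
    field
      multiplier : Carrier
      equation   : a ≈ b + multiplier · h

  ≈⇒∼ : ∀ {a b} → a ≈ b → a ∼ b
  ≈⇒∼ {a} {b} p = modulo 0# (trans p (solve 2 (λ b h → b := b :+ :0 :* h) refl b h))

  ∼-sym : ∀ {a b} → a ∼ b → b ∼ a
  ∼-sym {a} {b} (modulo m p) = modulo (- m) (trans
    (solve 3 (λ b m h → b := (b :+ m :* h) :+ (:- m) :* h) refl b m h) (+-congʳ (sym p)))

  ∼-trans : ∀ {a b d} → a ∼ b → b ∼ d → a ∼ d
  ∼-trans {a} {b} {d} (modulo m p) (modulo n q) = modulo (n + m) (trans p (trans (+-congʳ q)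
    (solve 4 (λ d m n h → (d :+ n :* h) :+ m :* h := d :+ (n :+ m) :* h) refl d m n h)))

  ∼-+-cong : ∀ {a b d e} → a ∼ b → d ∼ e → a + d ∼ b + e
  ∼-+-cong {a} {b} {d} {e} (modulo m p) (modulo n q) = modulo (m + n) (trans (+-cong p q)
    (solve 5 (λ b e m n h → (b :+ m :* h) :+ (e :+ n :* h) := (b :+ e) :+ (m :+ n) :* h) refl b e m n h))

  ∼-*-cong : ∀ {a b d e} → a ∼ b → d ∼ e → a · d ∼ b · e
  ∼-*-cong {a} {b} {d} {e} (modulo m p) (modulo n q) = modulo (b · n + m · e + m · n · h) (trans (*-cong p q)
    (solve 5 (λ b e m n h → (b :+ m :* h) :* (e :+ n :* h) := (b :* e) :+ (b :* n :+ m :* e :+ m :* n :* h) :* h) refl b e m n h))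

  ∼-neg-cong : ∀ {a b} → a ∼ b → - a ∼ - b
  ∼-neg-cong {a} {b} (modulo m p) = modulo (- m) (trans (-‿cong p)
    (solve 3 (λ b m h → :- (b :+ m :* h) := :- b :+ (:- m) :* h) refl b m h))

  quotientRing : CommutativeRing c (c ⊔ ℓ)
  quotientRing = record
    { Carrier = Carrier ; _≈_ = _∼_ ; _+_ = _+_ ; _*_ = _·_ ; -_ = -_ ; 0# = 0# ; 1# = 1#
    ; isCommutativeRing = record
      { isRing = record
        { +-isAbelianGroup = record
          { isGroup = record
            { isMonoid = record
              { isSemigroup = record
                { isMagma = record
                  { isEquivalence = record { refl = ≈⇒∼ refl ; sym = ∼-sym ; trans = ∼-trans }
                  ; ∙-cong = ∼-+-cong }
                ; assoc = λ x y z → ≈⇒∼ (+-assoc x y z) }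
              ; identity = (λ x → ≈⇒∼ (+-identityˡ x)) , (λ x → ≈⇒∼ (+-identityʳ x)) }
            ; inverse = (λ x → ≈⇒∼ (-‿inverseˡ x)) , (λ x → ≈⇒∼ (-‿inverseʳ x))
            ; ⁻¹-cong = ∼-neg-cong }
          ; comm = λ x y → ≈⇒∼ (+-comm x y) }
        ; *-cong = ∼-*-cong
        ; *-assoc = λ x y z → ≈⇒∼ (*-assoc x y z)
        ; *-identity = (λ x → ≈⇒∼ (*-identityˡ x)) , (λ x → ≈⇒∼ (*-identityʳ x))
        ; distrib = (λ x y z → ≈⇒∼ (distribˡ x y z)) , (λ x y z → ≈⇒∼ (distribʳ x y z)) }
      ; *-comm = λ x y → ≈⇒∼ (*-comm x y) } }

-- Squares have index at most two in a finite field.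

module IndexTwo {c ℓ} (R : CommutativeRing c ℓ) where
  open CommutativeRing R renaming (_*_ to _·_)
  open RingLemmas R
  open RingProperties ring using (-‿involutive; -‿distribʳ-*)
  open IntegerSolver R

  module _ (_≟_ : ∀ x y → Dec (x ≈ y)) (zero-or-unit : ZeroOrUnit)
           (elements : List Carrier) (complete : ∀ x → Any (x ≈_) elements) where

    private
      domain = zero-or-unit⇒domain zero-or-unit

    -- Distinguishes x from - x by which of the two occurs first in the list.
    sign : List Carrier → Carrier → Bool
    sign []       x = true
    sign (e ∷ es) x with x ≟ e
    ... | yes _ = true
    ... | no  _ with x ≟ (- e)
    ...   | yes _ = false
    ...   | no  _ = sign es x

    -- The first entry that equals x or - x equals y or - y as well, because x = - y: it meets one
    -- of x, y plainly and the other negated. Equal signs then leave only x = y.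
    sign-faithful : ∀ es x y → Any (x ≈_) es → x ≈ - y → sign es x ≡ sign es y → x ≈ y
    sign-faithful (e ∷ es) x y any x≈-y eq with x ≟ e | y ≟ e
    ... | yes p | yes q = trans p (sym q)
    ... | yes p | no  q with y ≟ (- e)
    ...   | yes _ = contradiction eq λ ()
    ...   | no  r = contradiction (trans (sym (-‿involutive y)) (-‿cong (trans (sym x≈-y) p))) r
    sign-faithful (e ∷ es) x y any x≈-y eq | no p | yes q with x ≟ (- e)
    ...   | yes _ = contradiction eq λ ()
    ...   | no  r = contradiction (trans x≈-y (-‿cong q)) r
    sign-faithful (e ∷ es) x y (here x≈e) x≈-y eq | no p | no q = contradiction x≈e p
    sign-faithful (e ∷ es) x y (there any) x≈-y eq | no p | no q with x ≟ (- e) | y ≟ (- e)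
    ...   | yes r | yes s = trans r (sym s)
    ...   | yes r | no  s = contradiction (trans (sym (-‿involutive y)) (trans (-‿cong (trans (sym x≈-y) r)) (-‿involutive e))) q
    ...   | no  r | yes s = contradiction (trans x≈-y (trans (-‿cong s) (-‿involutive e))) p
    ...   | no  r | no  s = sign-faithful es x y any x≈-y eq

    module _ (ν : Carrier) (ν-nonsquare : ¬ Square ν) where

      scaledSquare : Bool → Carrier → Carrier
      scaledSquare true  x = x · x
      scaledSquare false x = ν · (x · x)

      -- Of each pair x, - x one member goes to x² and the other to ν x². This repairs the failure
      -- of squaring to be injective, and surjectivity of the repaired map is the index statement.
      twistedSquare : Carrier → Carrier
      twistedSquare x = scaledSquare (sign elements x) x

      ν≉0 : ¬ (ν ≈ 0#)
      ν≉0 ν≈0 = ν-nonsquare (0# , trans (zeroˡ 0#) (sym ν≈0))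

      -- If y were a unit, ν would be the square of x / y; hence both sides vanish.
      mixed-zero : ∀ {x y} → x · x ≈ ν · (y · y) → x ≈ y
      mixed-zero {x} {y} p with zero-or-unit y
      ... | inj₁ y≈0 = trans (square-zero domain (trans p (trans (*-congˡ (trans (*-congʳ y≈0) (zeroˡ y))) (zeroʳ ν)))) (sym y≈0)
      ... | inj₂ (z , inv) = ⊥-elim (ν-nonsquare (square-quotient inv (sym p)))

      same-square : ∀ {x y} → sign elements x ≡ sign elements y → x · x ≈ y · y → x ≈ y
      same-square {x} {y} same p with square-roots domain p
      ... | inj₁ x≈y  = x≈y
      ... | inj₂ x≈-y = sign-faithful elements x y (complete x) x≈-y same

      twistedSquare-injective : ∀ {x y} → twistedSquare x ≈ twistedSquare y → x ≈ y
      twistedSquare-injective {x} {y} p = go (sign elements x) (sign elements y) ≡.refl ≡.refl p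
        where
        go : ∀ s t → sign elements x ≡ s → sign elements y ≡ t → scaledSquare s x ≈ scaledSquare t y → x ≈ y
        go true  true  eq eq′ p = same-square (≡.trans eq (≡.sym eq′)) p
        go true  false eq eq′ p = mixed-zero p
        go false true  eq eq′ p = sym (mixed-zero (sym p))
        go false false eq eq′ p with domain ν (x · x - y · y) (trans (distribˡ ν _ _) (trans (+-congˡ (sym (-‿distribʳ-* ν (y · y)))) (≈⇒diff≈0 p)))
        ... | inj₁ ν≈0 = contradiction ν≈0 ν≉0
        ... | inj₂ q   = same-square (≡.trans eq (≡.sym eq′)) (diff≈0⇒≈ q)

      orbit : Carrier → ℕ → Carrier
      orbit u zero    = u
      orbit u (suc k) = twistedSquare (orbit u k)

      returns : ∀ u i j → i < j → orbit u i ≈ orbit u j → ∃ λ k → u ≈ orbit u (suc k)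
      returns u zero    (suc j) _         p = j , p
      returns u (suc i) (suc j) (s≤s i<j) p = returns u i j i<j (twistedSquare-injective p)

      -- The iterates of the map on u must collide, and injectivity pulls the collision back to u
      -- itself, which thereby becomes a value. Nothing is counted, so repetitions in `elements` do
      -- no harm.
      twistedSquare-surjective : ∀ u → ∃ λ x → u ≈ twistedSquare x
      twistedSquare-surjective u with Fin.pigeonhole (ℕ.n<1+n (length elements)) (λ i → index (complete (orbit u (toℕ i))))
      ... | i , j , i<j , eq with returns u (toℕ i) (toℕ j) i<j
            (trans (lookup-index (complete (orbit u (toℕ i)))) (trans (reflexive (≡.cong (lookup elements) eq))
              (sym (lookup-index (complete (orbit u (toℕ j)))))))
      ...   | k , p = orbit u k , p

      index-two : ∀ u → Square u ⊎ Square (ν · u)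
      index-two u with twistedSquare-surjective u
      ... | x , p with sign elements x
      ...   | true  = inj₁ (x , sym p)
      ...   | false = inj₂ (ν · x , trans (solve 2 (λ ν x → (ν :* x) :* (ν :* x) := ν :* (ν :* (x :* x))) refl ν x) (*-congˡ (sym p)))

-- A square root of b - δ from a quadratic equation for δ.

module QuadraticTower {c ℓ} (R : CommutativeRing c ℓ) (zero-or-unit : RingLemmas.ZeroOrUnit R) where
  open CommutativeRing R renaming (_*_ to _·_)
  open RingLemmas R
  open IntegerSolver R

  private
    domain = zero-or-unit⇒domain zero-or-unit

  2# : Carrier
  2# = 1# + 1#

  module _ (b e t ρ : Carrier) (b²≈-2e : b · b + 2# · e ≈ 0#) (ρ²≈½ : 2# · (ρ · ρ) - 1# ≈ 0#) where

    -- The square root of the norm (b - δ)(b - δ′) of b - δ, where δ and δ′ are the roots of X² - s X + t,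
    -- and the trace of b - δ plus twice that root.
    rootNorm shiftedTrace : Carrier → Carrier
    rootNorm s     = (b - s) · ρ
    shiftedTrace s = 2# · b - s + 2# · rootNorm s

    -- An element z of trace τ and norm n² satisfies (z + n)² = z (τ + 2n).
    square-sum : ∀ δ s → s · s - 2# · (t - e) ≈ 0# → δ · δ - s · δ + t ≈ 0# →
      ((b - δ) + rootNorm s) · ((b - δ) + rootNorm s) ≈ (b - δ) · shiftedTrace s
    square-sum δ s s²≈ quad = trans
      -- The sides differ by a combination of the four expressions assumed to vanish; the calls of
      -- `+zeros` remove them from the outside in. The cofactor t - 2e - b s of 2ρ² - 1 is the norm
      -- of b - δ.
      (solve 6 (λ b e t ρ δ s → let two = :1 :+ :1 in
        ((b :- δ) :+ (b :- s) :* ρ) :* ((b :- δ) :+ (b :- s) :* ρ) :=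
        ((((b :- δ) :* (two :* b :- s :+ two :* ((b :- s) :* ρ)) :+ :1 :* (δ :* δ :- s :* δ :+ t))
          :+ (ρ :* ρ :- :1) :* (b :* b :+ two :* e)) :+ (ρ :* ρ) :* (s :* s :- two :* (t :- e)))
          :+ (t :- two :* e :- b :* s) :* (two :* (ρ :* ρ) :- :1))
        refl b e t ρ δ s)
      (trans (+zeros ρ²≈½) (trans (+zeros s²≈) (trans (+zeros b²≈-2e) (+zeros quad))))

    -- With z = b - δ and n = `rootNorm s`, dividing (z + n)² = z y² by y² settles the case of a
    -- unit y. If y = 0, then z = - n, and this is where the assumption on `- rootNorm s` serves.
    square-from-quadratic : ∀ δ s → s · s - 2# · (t - e) ≈ 0# → δ · δ - s · δ + t ≈ 0# →
      Square (shiftedTrace s) → Square (- rootNorm s) → Square (b - δ)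
    square-from-quadratic δ s s²≈ quad (y , yy≈w) -n-square with zero-or-unit y
    ... | inj₁ y≈0 = square-resp (sym (sum≈0⇒≈- (square-zero domain (trans (square-sum δ s s²≈ quad)
            (trans (*-congˡ (trans (sym yy≈w) (trans (*-congʳ y≈0) (zeroˡ y)))) (zeroʳ _)))))) -n-square
    ... | inj₂ (y⁻¹ , inv) = square-quotient inv (trans (*-congˡ yy≈w) (sym (square-sum δ s s²≈ quad)))

    -- Under these hypotheses (δ² + t)² = (s δ)².
    square-in-tower : ∀ δ s → s · s - 2# · (t - e) ≈ 0# →
      (δ · δ + e) · (δ · δ + e) - (e · e - t · t) ≈ 0# →
      Square (shiftedTrace s) → Square (- rootNorm s) →
      Square (shiftedTrace (- s)) → Square (- rootNorm (- s)) → Square (b - δ)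
    square-in-tower δ s s²≈ quartic w-square n-square w′-square n′-square
      -- The product of the two quadratics is (δ² + t)² - s² δ², which vanishes. Which factor
      -- vanishes is not known in advance, so the square assumptions come for both s and - s.
      with domain (δ · δ - s · δ + t) (δ · δ - (- s) · δ + t) (trans
        (solve 4 (λ e t δ s → let two = :1 :+ :1 in
          (δ :* δ :- s :* δ :+ t) :* (δ :* δ :- (:- s) :* δ :+ t) :=
          (:0 :+ :1 :* ((δ :* δ :+ e) :* (δ :* δ :+ e) :- (e :* e :- t :* t)))
            :+ (:- (δ :* δ)) :* (s :* s :- two :* (t :- e)))
          refl e t δ s)
        (trans (+zeros s²≈) (+zeros quartic)))
    ... | inj₁ quad = square-from-quadratic δ s s²≈ quad w-square n-square
    ... | inj₂ quad = square-from-quadratic δ (- s)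
          (trans (+-congʳ (solve 1 (λ s → (:- s) :* (:- s) := s :* s) refl s)) s²≈) quad w′-square n′-square

-- Polynomials as coefficient lists: ring structure and Horner evaluation.

module PolynomialRing {c} (F : FiniteField c) where
  open FiniteField F hiding (_*_) renaming (Carrier to 𝔽)
  open FiniteField F using () renaming (_*_ to _·_)
  open FieldDefs F

  fieldRing : CommutativeRing c c
  fieldRing = record { isCommutativeRing = isCommutativeRing }

  open CommutativeRing fieldRing
    using (+-identityˡ; +-identityʳ; +-assoc; +-comm; -‿inverseˡ; -‿inverseʳ; *-assoc; *-comm; *-identityˡ; distribˡ; distribʳ; zeroˡ; zeroʳ)
  open RingProperties (CommutativeRing.ring fieldRing) using (-1*x≈-x)

  infix 4 _≋_
  -- `_≈P_` unfolds to a function type, from which unification cannot recover `p` and `q`; the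
  -- record keeps them.
  record _≋_ (p q : Poly) : Set c where
    constructor coeffwise
    field at : p ≈P q
  open _≋_ public

  ≋-refl : ∀ {p} → p ≋ p
  ≋-refl = coeffwise λ _ → ≡.refl

  ≋-sym : ∀ {p q} → p ≋ q → q ≋ p
  ≋-sym e = coeffwise λ i → ≡.sym (at e i)

  ≋-trans : ∀ {p q r} → p ≋ q → q ≋ r → p ≋ r
  ≋-trans e e′ = coeffwise λ i → ≡.trans (at e i) (at e′ i)

  ∷-cong : ∀ {a b p q} → a ≡ b → p ≋ q → a ∷ p ≋ b ∷ q
  ∷-cong eq e = coeffwise λ { zero → eq ; (suc i) → at e i }

  tail-≋ : ∀ {a b p q} → a ∷ p ≋ b ∷ q → p ≋ q
  tail-≋ e = coeffwise λ i → at e (suc i)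

  0∷[]≋[] : 0# ∷ [] ≋ []
  0∷[]≋[] = coeffwise λ { zero → ≡.refl ; (suc i) → ≡.refl }

  coeff-+ : ∀ p q i → coeff (p +P q) i ≡ coeff p i + coeff q i
  coeff-+ []      q       i       = ≡.sym (+-identityˡ _)
  coeff-+ (a ∷ p) []      i       = ≡.sym (+-identityʳ _)
  coeff-+ (a ∷ p) (b ∷ q) zero    = ≡.refl
  coeff-+ (a ∷ p) (b ∷ q) (suc i) = coeff-+ p q i

  coeff-scale : ∀ a p i → coeff (scale a p) i ≡ a · coeff p i
  coeff-scale a []      i       = ≡.sym (zeroʳ a)
  coeff-scale a (b ∷ p) zero    = ≡.refl
  coeff-scale a (b ∷ p) (suc i) = coeff-scale a p i

  negP : Poly → Poly
  negP = scale (- 1#)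

  coeff-neg : ∀ p i → coeff (negP p) i ≡ - coeff p i
  coeff-neg p i = ≡.trans (coeff-scale (- 1#) p i) (-1*x≈-x _)

  +P-cong : ∀ {p q r s} → p ≋ q → r ≋ s → p +P r ≋ q +P s
  +P-cong {p} {q} {r} {s} e e′ = coeffwise λ i →
    ≡.trans (coeff-+ p r i) (≡.trans (≡.cong₂ _+_ (at e i) (at e′ i)) (≡.sym (coeff-+ q s i)))

  scale-cong : ∀ {a b p q} → a ≡ b → p ≋ q → scale a p ≋ scale b q
  scale-cong {a} {b} {p} {q} eq e = coeffwise λ i →
    ≡.trans (coeff-scale a p i) (≡.trans (≡.cong₂ _·_ eq (at e i)) (≡.sym (coeff-scale b q i)))

  +P-assoc : ∀ p q r → (p +P q) +P r ≋ p +P (q +P r)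
  +P-assoc p q r = coeffwise λ i → begin
    coeff ((p +P q) +P r) i              ≡⟨ coeff-+ (p +P q) r i ⟩
    coeff (p +P q) i + coeff r i         ≡⟨ ≡.cong (_+ coeff r i) (coeff-+ p q i) ⟩
    coeff p i + coeff q i + coeff r i    ≡⟨ +-assoc _ _ _ ⟩
    coeff p i + (coeff q i + coeff r i)  ≡⟨ ≡.cong (coeff p i +_) (coeff-+ q r i) ⟨
    coeff p i + coeff (q +P r) i         ≡⟨ coeff-+ p (q +P r) i ⟨
    coeff (p +P (q +P r)) i              ∎
    where open ≡.≡-Reasoning

  +P-comm : ∀ p q → p +P q ≋ q +P p
  +P-comm p q = coeffwise λ i → ≡.trans (coeff-+ p q i) (≡.trans (+-comm _ _) (≡.sym (coeff-+ q p i)))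

  +P-identityˡ : ∀ p → [] +P p ≋ p
  +P-identityˡ p = ≋-refl

  +P-identityʳ : ∀ p → p +P [] ≋ p
  +P-identityʳ p = +P-comm p []

  +P-inverseˡ : ∀ p → negP p +P p ≋ []
  +P-inverseˡ p = coeffwise λ i →
    ≡.trans (coeff-+ (negP p) p i) (≡.trans (≡.cong (_+ coeff p i) (coeff-neg p i)) (-‿inverseˡ _))

  +P-inverseʳ : ∀ p → p +P negP p ≋ []
  +P-inverseʳ p = ≋-trans (+P-comm p (negP p)) (+P-inverseˡ p)

  +P-isAbelianGroup : IsAbelianGroup _≋_ _+P_ [] negP
  +P-isAbelianGroup = record
    { isGroup = record
      { isMonoid = record
        { isSemigroup = record
          { isMagma = record
            { isEquivalence = record { refl = ≋-refl ; sym = ≋-sym ; trans = ≋-trans }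
            ; ∙-cong = +P-cong }
          ; assoc = +P-assoc }
        ; identity = +P-identityˡ , +P-identityʳ }
      ; inverse = +P-inverseˡ , +P-inverseʳ
      ; ⁻¹-cong = scale-cong ≡.refl }
    ; comm = +P-comm }

  private
    +P-abelianGroup : AbelianGroup c c
    +P-abelianGroup = record { isAbelianGroup = +P-isAbelianGroup }

  open CommutativeSemigroupProperties (AbelianGroup.commutativeSemigroup +P-abelianGroup)
    using (interchange; x∙yz≈y∙xz)

  scale-distrib : ∀ a p q → scale a (p +P q) ≋ scale a p +P scale a q
  scale-distrib a p q = coeffwise λ i → begin
    coeff (scale a (p +P q)) i               ≡⟨ coeff-scale a (p +P q) i ⟩
    a · coeff (p +P q) i                     ≡⟨ ≡.cong (a ·_) (coeff-+ p q i) ⟩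
    a · (coeff p i + coeff q i)              ≡⟨ distribˡ _ _ _ ⟩
    a · coeff p i + a · coeff q i            ≡⟨ ≡.cong₂ _+_ (coeff-scale a p i) (coeff-scale a q i) ⟨
    coeff (scale a p) i + coeff (scale a q) i ≡⟨ coeff-+ (scale a p) (scale a q) i ⟨
    coeff (scale a p +P scale a q) i         ∎
    where open ≡.≡-Reasoning

  scale-+ : ∀ a b p → scale (a + b) p ≋ scale a p +P scale b p
  scale-+ a b p = coeffwise λ i → begin
    coeff (scale (a + b) p) i                ≡⟨ coeff-scale (a + b) p i ⟩
    (a + b) · coeff p i                      ≡⟨ distribʳ _ _ _ ⟩
    a · coeff p i + b · coeff p i            ≡⟨ ≡.cong₂ _+_ (coeff-scale a p i) (coeff-scale b p i) ⟨
    coeff (scale a p) i + coeff (scale b p) i ≡⟨ coeff-+ (scale a p) (scale b p) i ⟨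
    coeff (scale a p +P scale b p) i         ∎
    where open ≡.≡-Reasoning

  scale-scale : ∀ a b p → scale a (scale b p) ≋ scale (a · b) p
  scale-scale a b p = coeffwise λ i → begin
    coeff (scale a (scale b p)) i   ≡⟨ coeff-scale a (scale b p) i ⟩
    a · coeff (scale b p) i         ≡⟨ ≡.cong (a ·_) (coeff-scale b p i) ⟩
    a · (b · coeff p i)             ≡⟨ *-assoc _ _ _ ⟨
    a · b · coeff p i               ≡⟨ coeff-scale (a · b) p i ⟨
    coeff (scale (a · b) p) i       ∎
    where open ≡.≡-Reasoning

  scale-1 : ∀ p → scale 1# p ≋ p
  scale-1 p = coeffwise λ i → ≡.trans (coeff-scale 1# p i) (*-identityˡ _)

  scale-0 : ∀ p → scale 0# p ≋ []
  scale-0 p = coeffwise λ i → ≡.trans (coeff-scale 0# p i) (zeroˡ _)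

  *P-zeroʳ : ∀ p → p *P [] ≋ []
  *P-zeroʳ []      = ≋-refl
  *P-zeroʳ (a ∷ p) = ≋-trans (∷-cong ≡.refl (*P-zeroʳ p)) 0∷[]≋[]

  *P-congˡ : ∀ p {q r} → q ≋ r → p *P q ≋ p *P r
  *P-congˡ []      e = ≋-refl
  *P-congˡ (a ∷ p) e = +P-cong (scale-cong ≡.refl e) (∷-cong ≡.refl (*P-congˡ p e))

  -- Lists of different lengths may be equal as polynomials; this absorbs the surplus zeros in
  -- `*P-congʳ`.
  *P-nullˡ : ∀ {p} q → p ≋ [] → p *P q ≋ []
  *P-nullˡ {[]}    q e = ≋-refl
  *P-nullˡ {a ∷ p} q e = +P-cong (≋-trans (scale-cong (at e 0) ≋-refl) (scale-0 q))
    (≋-trans (∷-cong ≡.refl (*P-nullˡ {p} q (coeffwise λ i → at e (suc i)))) 0∷[]≋[])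

  *P-congʳ : ∀ {p q} r → p ≋ q → p *P r ≋ q *P r
  *P-congʳ {[]}    {q}     r e = ≋-sym (*P-nullˡ r (≋-sym e))
  *P-congʳ {a ∷ p} {[]}    r e = *P-nullˡ r e
  *P-congʳ {a ∷ p} {b ∷ q} r e = +P-cong (scale-cong (at e 0) ≋-refl) (∷-cong ≡.refl (*P-congʳ r (tail-≋ e)))

  *P-cong : ∀ {p q r s} → p ≋ q → r ≋ s → p *P r ≋ q *P s
  *P-cong {p} {q} {r} {s} e e′ = ≋-trans (*P-congʳ r e) (*P-congˡ q e′)

  -- The recursion of `_*P_` transposed to the second factor, from which commutativity follows by
  -- induction.
  *P-∷ : ∀ p b q → p *P (b ∷ q) ≋ scale b p +P (0# ∷ (p *P q))
  *P-∷ []      b q = ≋-sym 0∷[]≋[]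
  *P-∷ (a ∷ p) b q = ∷-cong (≡.cong (_+ 0#) (*-comm a b))
    (≋-trans (+P-cong ≋-refl (*P-∷ p b q)) (x∙yz≈y∙xz (scale a q) (scale b p) _))

  *P-comm : ∀ p q → p *P q ≋ q *P p
  *P-comm []      q = ≋-sym (*P-zeroʳ q)
  *P-comm (a ∷ p) q = ≋-trans (+P-cong ≋-refl (∷-cong ≡.refl (*P-comm p q))) (≋-sym (*P-∷ q a p))

  *P-distribʳ : ∀ r p q → (p +P q) *P r ≋ (p *P r) +P (q *P r)
  *P-distribʳ r []      q       = ≋-refl
  *P-distribʳ r (a ∷ p) []      = ≋-sym (+P-identityʳ _)
  *P-distribʳ r (a ∷ p) (b ∷ q) = ≋-trans
    (+P-cong (scale-+ a b r) (≋-trans (∷-cong (≡.sym (+-identityʳ 0#)) (*P-distribʳ r p q)) ≋-refl))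
    (interchange (scale a r) (scale b r) (0# ∷ (p *P r)) (0# ∷ (q *P r)))

  scale-*P : ∀ a p q → scale a p *P q ≋ scale a (p *P q)
  scale-*P a []      q = ≋-refl
  scale-*P a (b ∷ p) q = ≋-sym (≋-trans (scale-distrib a (scale b q) _)
    (+P-cong (scale-scale a b q) (∷-cong (zeroʳ a) (≋-sym (scale-*P a p q)))))

  shift-*P : ∀ p q → (0# ∷ p) *P q ≋ 0# ∷ (p *P q)
  shift-*P p q = +P-cong (scale-0 q) ≋-refl

  *P-assoc : ∀ p q r → (p *P q) *P r ≋ p *P (q *P r)
  *P-assoc []      q r = ≋-refl
  *P-assoc (a ∷ p) q r = ≋-trans (*P-distribʳ r (scale a q) _)
    (+P-cong (scale-*P a q r) (≋-trans (shift-*P (p *P q) r) (∷-cong ≡.refl (*P-assoc p q r))))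

  *P-identityˡ : ∀ p → (1# ∷ []) *P p ≋ p
  *P-identityˡ p = ≋-trans (+P-cong (scale-1 p) 0∷[]≋[]) (+P-identityʳ p)

  polynomialRing : CommutativeRing c c
  polynomialRing = record
    { Carrier = Poly ; _≈_ = _≋_ ; _+_ = _+P_ ; _*_ = _*P_ ; -_ = negP ; 0# = [] ; 1# = 1# ∷ []
    ; isCommutativeRing = record
      { isRing = record
        { +-isAbelianGroup = +P-isAbelianGroup
        ; *-cong = *P-cong
        ; *-assoc = *P-assoc
        ; *-identity = *P-identityˡ , λ p → ≋-trans (*P-comm p _) (*P-identityˡ p)
        ; distrib = (λ r p q → ≋-trans (*P-comm r _) (≋-trans (*P-distribʳ r p q) (+P-cong (*P-comm p r) (*P-comm q r))))
                  , *P-distribʳ }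
      ; *-comm = *P-comm } }

  const : 𝔽 → Poly
  const a = a ∷ []

  X : Poly
  X = 0# ∷ 1# ∷ []

  scale≋*P : ∀ a p → scale a p ≋ const a *P p
  scale≋*P a p = ≋-sym (≋-trans (+P-cong ≋-refl 0∷[]≋[]) (+P-identityʳ _))

  -- Turns the list constructor into a ring expression, so that ring identities apply to lists.
  ∷≋ : ∀ a p → a ∷ p ≋ const a +P (X *P p)
  ∷≋ a p = ≋-sym (≋-trans (+P-cong {const a} ≋-refl (≋-trans (shift-*P (1# ∷ []) p) (∷-cong ≡.refl (*P-identityˡ p))))
    (∷-cong (+-identityʳ a) ≋-refl))

-- `eval` and `compose` are both instances.
module Evaluation {c ℓ} (F : FiniteField c) (A : CommutativeRing c ℓ) where
  open FiniteField F using () renaming (Carrier to 𝔽; _+_ to _+F_; _*_ to _*F_; 0# to 0F; 1# to 1F)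
  open FieldDefs F
  open PolynomialRing F
  open CommutativeRing A renaming (_*_ to _·_)
  open IntegerSolver A

  module At
    (ι : 𝔽 → Carrier) (ι-+ : ∀ a b → ι (a +F b) ≈ ι a + ι b) (ι-* : ∀ a b → ι (a *F b) ≈ ι a · ι b)
    (ι-0 : ι 0F ≈ 0#) (ι-1 : ι 1F ≈ 1#) (evalA : Poly → Carrier) (x : Carrier)
    (evalA-[] : evalA [] ≈ 0#) (evalA-∷ : ∀ a p → evalA (a ∷ p) ≈ ι a + x · evalA p) where

    evalA-null : ∀ p → p ≋ [] → evalA p ≈ 0#
    evalA-null []      e = evalA-[]
    evalA-null (a ∷ p) e = trans (evalA-∷ a p) (trans
      (+-cong (trans (reflexive (≡.cong ι (at e 0))) ι-0) (*-congˡ (evalA-null p (coeffwise λ i → at e (suc i)))))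
      (trans (+-congˡ (zeroʳ x)) (+-identityʳ 0#)))

    evalA-cong : ∀ {p q} → p ≋ q → evalA p ≈ evalA q
    evalA-cong {[]}    {q}     e = trans evalA-[] (sym (evalA-null q (≋-sym e)))
    evalA-cong {a ∷ p} {[]}    e = trans (evalA-null (a ∷ p) e) (sym evalA-[])
    evalA-cong {a ∷ p} {b ∷ q} e = trans (evalA-∷ a p) (trans
      (+-cong (reflexive (≡.cong ι (at e 0))) (*-congˡ (evalA-cong (tail-≋ e)))) (sym (evalA-∷ b q)))

    evalA-+ : ∀ p q → evalA (p +P q) ≈ evalA p + evalA q
    evalA-+ []      q       = trans (sym (+-identityˡ _)) (+-congʳ (sym evalA-[]))
    evalA-+ (a ∷ p) []      = trans (sym (+-identityʳ _)) (+-congˡ (sym evalA-[]))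
    evalA-+ (a ∷ p) (b ∷ q) = trans (evalA-∷ _ (p +P q)) (trans (+-cong (ι-+ a b) (*-congˡ (evalA-+ p q)))
      (trans (solve 5 (λ a b x u v → (a :+ b) :+ x :* (u :+ v) := (a :+ x :* u) :+ (b :+ x :* v)) refl (ι a) (ι b) x (evalA p) (evalA q))
        (+-cong (sym (evalA-∷ a p)) (sym (evalA-∷ b q)))))

    evalA-scale : ∀ a p → evalA (scale a p) ≈ ι a · evalA p
    evalA-scale a []      = trans evalA-[] (sym (trans (*-congˡ evalA-[]) (zeroʳ _)))
    evalA-scale a (b ∷ p) = trans (evalA-∷ _ (scale a p)) (trans (+-cong (ι-* a b) (*-congˡ (evalA-scale a p)))
      (trans (solve 4 (λ a b x u → a :* b :+ x :* (a :* u) := a :* (b :+ x :* u)) refl (ι a) (ι b) x (evalA p))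
        (*-congˡ (sym (evalA-∷ b p)))))

    evalA-* : ∀ p q → evalA (p *P q) ≈ evalA p · evalA q
    evalA-* []      q = trans evalA-[] (sym (trans (*-congʳ evalA-[]) (zeroˡ _)))
    evalA-* (a ∷ p) q = trans (evalA-+ (scale a q) _) (trans (+-cong (evalA-scale a q)
        (trans (evalA-∷ _ (p *P q)) (+-cong ι-0 (*-congˡ (evalA-* p q)))))
      (trans (solve 4 (λ a x u v → a :* v :+ (:0 :+ x :* (u :* v)) := (a :+ x :* u) :* v) refl (ι a) x (evalA p) (evalA q))
        (*-congʳ (sym (evalA-∷ a p)))))

    evalA-const : ∀ a → evalA (const a) ≈ ι a
    evalA-const a = trans (evalA-∷ a []) (trans (+-congˡ (trans (*-congˡ evalA-[]) (zeroʳ x))) (+-identityʳ _))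

    evalA-1 : evalA (const 1F) ≈ 1#
    evalA-1 = trans (evalA-const _) ι-1

    evalA-X : evalA X ≈ x
    evalA-X = trans (evalA-∷ _ _) (trans (+-cong ι-0 (*-congˡ evalA-1)) (trans (+-identityˡ _) (*-identityʳ x)))

    evalA-neg : ∀ p → evalA (negP p) ≈ - evalA p
    evalA-neg p = RingProperties.+-inverseˡ-unique ring _ _
      (trans (sym (evalA-+ (negP p) p)) (evalA-null _ (+P-inverseˡ p)))

-- Degrees, division, Euclid's algorithm and residue fields.

module PolynomialDegree {c} (F : FiniteField c) where
  open FiniteField F hiding (_*_) renaming (Carrier to 𝔽)
  open FiniteField F using () renaming (_*_ to _·_)
  open FieldDefs F
  open PolynomialRing F
  open CommutativeRing fieldRing
    using (+-identityˡ; +-identityʳ; -‿inverseʳ; *-assoc; *-comm; *-identityˡ; *-identityʳ; zeroˡ; zeroʳ)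
  open RingProperties (CommutativeRing.ring fieldRing) using (-0#≈0#)
  open RingLemmas polynomialRing using (Domain; division-step; bezout-step; cofactor-step; regroup; inverse-modulo)
  open ≡.≡-Reasoning

  field-zero-or-unit : RingLemmas.ZeroOrUnit fieldRing
  field-zero-or-unit x with x ≟ 0#
  ... | yes p = inj₁ p
  ... | no  p = inj₂ (inverse x p)

  field-domain : RingLemmas.Domain fieldRing
  field-domain = RingLemmas.zero-or-unit⇒domain fieldRing field-zero-or-unit

  infixl 6 _-P_
  _-P_ : Poly → Poly → Poly
  p -P q = p +P negP q

  coeff-- : ∀ p q i → coeff (p -P q) i ≡ coeff p i + - coeff q i
  coeff-- p q i = ≡.trans (coeff-+ p (negP q) i) (≡.cong (λ z → coeff p i + z) (coeff-neg q i))

  coeff-const-* : ∀ a p i → coeff (const a *P p) i ≡ a · coeff p i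
  coeff-const-* a p i = ≡.trans (≡.sym (at (scale≋*P a p) i)) (coeff-scale a p i)

  -- Degree below `n`, the zero polynomial included. Bounds and degrees are relations, so they
  -- respect `_≋_` without any normalisation of lists.
  record Bounded (n : ℕ) (p : Poly) : Set c where
    constructor bounded
    field beyond : ∀ i → n ≤ i → coeff p i ≡ 0#
  open Bounded public

  record HasDegree (n : ℕ) (p : Poly) : Set c where
    constructor hasDegree
    field
      leading≢0 : ¬ (coeff p n ≡ 0#)
      bound     : Bounded (suc n) p
  open HasDegree public

  Bounded-resp : ∀ {n p q} → p ≋ q → Bounded n p → Bounded n q
  Bounded-resp e b = bounded λ i n≤i → ≡.trans (≡.sym (at e i)) (beyond b i n≤i)

  Bounded-≤ : ∀ {m n p} → m ≤ n → Bounded m p → Bounded n p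
  Bounded-≤ m≤n b = bounded λ i n≤i → beyond b i (ℕ.≤-trans m≤n n≤i)

  Bounded-tail : ∀ {n a p} → Bounded (suc n) (a ∷ p) → Bounded n p
  Bounded-tail b = bounded λ i n≤i → beyond b (suc i) (s≤s n≤i)

  Bounded-∷ : ∀ {n p} a → Bounded n p → Bounded (suc n) (a ∷ p)
  Bounded-∷ a b = bounded λ { (suc i) (s≤s n≤i) → beyond b i n≤i }

  Bounded-- : ∀ {n p q} → Bounded n p → Bounded n q → Bounded n (p -P q)
  Bounded-- {n} {p} {q} b b′ = bounded λ i n≤i → begin
    coeff (p -P q) i          ≡⟨ coeff-- p q i ⟩
    coeff p i + - coeff q i   ≡⟨ ≡.cong₂ (λ x y → x + - y) (beyond b i n≤i) (beyond b′ i n≤i) ⟩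
    0# + - 0#                 ≡⟨ -‿inverseʳ 0# ⟩
    0#                        ∎

  Bounded-const-* : ∀ {n p} a → Bounded n p → Bounded n (const a *P p)
  Bounded-const-* {n} {p} a b = bounded λ i n≤i →
    ≡.trans (coeff-const-* a p i) (≡.trans (≡.cong (a ·_) (beyond b i n≤i)) (zeroʳ a))

  Bounded-pred : ∀ {n p} → coeff p n ≡ 0# → Bounded (suc n) p → Bounded n p
  Bounded-pred {n} {p} top b = bounded λ i n≤i → split i (ℕ.m≤n⇒m<n∨m≡n n≤i)
    where
    split : ∀ i → n < i ⊎ n ≡ i → coeff p i ≡ 0#
    split i (inj₁ n<i)    = beyond b i n<i
    split i (inj₂ ≡.refl) = top

  Bounded-0 : ∀ {p} → Bounded 0 p → p ≋ []
  Bounded-0 b = coeffwise λ i → beyond b i z≤n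

  Bounded-1 : ∀ {p} → Bounded 1 p → p ≋ const (coeff p 0)
  Bounded-1 b = coeffwise λ { zero → ≡.refl ; (suc i) → beyond b (suc i) (s≤s z≤n) }

  degree? : ∀ p → p ≋ [] ⊎ ∃ λ n → HasDegree n p
  degree? []      = inj₁ ≋-refl
  degree? (a ∷ p) with degree? p | a ≟ 0#
  ... | inj₂ (n , hasDegree l b) | _       = inj₂ (suc n , hasDegree l (Bounded-∷ a b))
  ... | inj₁ p≋0                 | yes a≡0 = inj₁ (≋-trans (∷-cong a≡0 p≋0) 0∷[]≋[])
  ... | inj₁ p≋0                 | no  a≢0 = inj₂ (0 , hasDegree a≢0 (Bounded-∷ a (bounded λ i _ → at p≋0 i)))

  HasDegree≢0 : ∀ {n p} → HasDegree n p → ¬ (p ≋ [])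
  HasDegree≢0 {n} d e = leading≢0 d (at e n)

  HasDegree-resp : ∀ {n p q} → p ≋ q → HasDegree n p → HasDegree n q
  HasDegree-resp {n} e d = hasDegree (leading≢0 d ∘ ≡.trans (at e n)) (Bounded-resp e (bound d))

  HasDegree<bound : ∀ {m n p} → HasDegree m p → Bounded n p → m < n
  HasDegree<bound {m} {n} d b with m ℕ.<? n
  ... | yes m<n = m<n
  ... | no  m≮n = contradiction (beyond b m (ℕ.≮⇒≥ m≮n)) (leading≢0 d)

  HasDegree-unique : ∀ {m n p} → HasDegree m p → HasDegree n p → m ≡ n
  HasDegree-unique d d′ = ℕ.≤-antisym (ℕ.s≤s⁻¹ (HasDegree<bound d (bound d′))) (ℕ.s≤s⁻¹ (HasDegree<bound d′ (bound d)))

  -- The bounds carry `suc` because it is the degrees, at most m and n, that add up.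
  Bounded-* : ∀ {m n} p q → Bounded (suc m) p → Bounded (suc n) q → Bounded (suc (m ℕ.+ n)) (p *P q)
  Bounded-* []      q b b′ = bounded λ _ _ → ≡.refl
  Bounded-* {m} {n} (a ∷ p) q b b′ = bounded λ i le → begin
    coeff ((a ∷ p) *P q) i                            ≡⟨ coeff-+ (scale a q) _ i ⟩
    coeff (scale a q) i + coeff (0# ∷ (p *P q)) i     ≡⟨ ≡.cong₂ _+_ (≡.trans (coeff-scale a q i)
      (≡.trans (≡.cong (a ·_) (beyond b′ i (ℕ.≤-trans (s≤s (ℕ.m≤n+m n m)) le))) (zeroʳ a))) (shifted m i b le) ⟩
    0# + 0#                                           ≡⟨ +-identityʳ 0# ⟩
    0#                                                ∎
    where
    shifted : ∀ m i → Bounded (suc m) (a ∷ p) → suc (m ℕ.+ n) ≤ i → coeff (0# ∷ (p *P q)) i ≡ 0#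
    shifted zero    (suc i) b le = at (*P-nullˡ q (Bounded-0 {p} (Bounded-tail b))) i
    shifted (suc m) (suc i) b (s≤s le) = beyond (Bounded-* p q (Bounded-tail b) b′) i le

  coeff-* : ∀ {m n} p q → Bounded (suc m) p → Bounded (suc n) q → coeff (p *P q) (m ℕ.+ n) ≡ coeff p m · coeff q n
  coeff-* []      q b b′ = ≡.sym (zeroˡ _)
  coeff-* {zero} {n} (a ∷ p) q b b′ = begin
    coeff ((a ∷ p) *P q) n                            ≡⟨ coeff-+ (scale a q) _ n ⟩
    coeff (scale a q) n + coeff (0# ∷ (p *P q)) n     ≡⟨ ≡.cong₂ _+_ (coeff-scale a q n)
      (≡.trans (at (∷-cong ≡.refl (*P-nullˡ q (Bounded-0 {p} (Bounded-tail b)))) n) (at 0∷[]≋[] n)) ⟩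
    a · coeff q n + 0#                                ≡⟨ +-identityʳ _ ⟩
    a · coeff q n                                     ∎
  coeff-* {suc m} {n} (a ∷ p) q b b′ = begin
    coeff ((a ∷ p) *P q) (suc (m ℕ.+ n))                       ≡⟨ coeff-+ (scale a q) _ (suc (m ℕ.+ n)) ⟩
    coeff (scale a q) (suc (m ℕ.+ n)) + coeff (p *P q) (m ℕ.+ n) ≡⟨ ≡.cong₂ _+_ (≡.trans (coeff-scale a q _)
      (≡.trans (≡.cong (a ·_) (beyond b′ _ (s≤s (ℕ.m≤n+m n m)))) (zeroʳ a))) (coeff-* p q (Bounded-tail b) b′) ⟩
    0# + coeff p m · coeff q n                                 ≡⟨ +-identityˡ _ ⟩
    coeff p m · coeff q n                                      ∎

  HasDegree-* : ∀ {m n p q} → HasDegree m p → HasDegree n q → HasDegree (m ℕ.+ n) (p *P q)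
  HasDegree-* {m} {n} {p} {q} d d′ = hasDegree nonzero (Bounded-* p q (bound d) (bound d′))
    where
    nonzero : ¬ (coeff (p *P q) (m ℕ.+ n) ≡ 0#)
    nonzero e with field-domain (coeff p m) (coeff q n) (≡.trans (≡.sym (coeff-* p q (bound d) (bound d′))) e)
    ... | inj₁ z = leading≢0 d z
    ... | inj₂ z = leading≢0 d′ z

  polynomial-domain : Domain
  polynomial-domain p q e with degree? p | degree? q
  ... | inj₁ p≋0     | _            = inj₁ p≋0
  ... | inj₂ _       | inj₁ q≋0     = inj₂ q≋0
  ... | inj₂ (m , d) | inj₂ (n , d′) = contradiction e (HasDegree≢0 (HasDegree-* d d′))

  module Division {d} (h : Poly) (deg : HasDegree d h) where
    open QuotientRing polynomialRing h

    -- Recursion along the coefficients: if r is the remainder of the tail, then a + X r has degree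
    -- at most d, and one scalar multiple of `h` removes its top coefficient.
    remainder : ∀ p → ∃ λ r → p ∼ r × Bounded d r
    remainder []      = [] , ≈⇒∼ ≋-refl , bounded λ _ _ → ≡.refl
    remainder (a ∷ p) with remainder p | inverse (coeff h d) (leading≢0 deg)
    ... | r , modulo q e , b | l⁻¹ , inv = (a ∷ r) -P const l *P h , modulo (X *P q +P const l) equation , Bounded-pred top
        (Bounded-- (Bounded-∷ a b) (Bounded-const-* l (bound deg)))
      where
      l = coeff (a ∷ r) d · l⁻¹
      equation : a ∷ p ≋ ((a ∷ r) -P const l *P h) +P (X *P q +P const l) *P h
      equation = ≋-trans (≋-trans (∷≋ a p) (+P-cong {const a} ≋-refl (*P-congˡ X e))) (≋-trans
        (division-step (const a) X r q h (const l))
        (+P-cong (+P-cong (≋-sym (∷≋ a r)) ≋-refl) ≋-refl))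
      top : coeff ((a ∷ r) -P const l *P h) d ≡ 0#
      top = begin
        coeff ((a ∷ r) -P const l *P h) d                ≡⟨ coeff-- (a ∷ r) (const l *P h) d ⟩
        coeff (a ∷ r) d + - coeff (const l *P h) d       ≡⟨ ≡.cong (λ z → coeff (a ∷ r) d + - z) (≡.trans (coeff-const-* l h d)
          (≡.trans (*-assoc _ _ _) (≡.trans (≡.cong (coeff (a ∷ r) d ·_) (≡.trans (*-comm _ _) inv)) (*-identityʳ _)))) ⟩
        coeff (a ∷ r) d + - coeff (a ∷ r) d              ≡⟨ -‿inverseʳ _ ⟩
        0#                                               ∎

    bounded-multiple : ∀ q → Bounded d (q *P h) → q ≋ []
    bounded-multiple q b with degree? q
    ... | inj₁ q≋0     = q≋0
    ... | inj₂ (m , e) = contradiction (HasDegree<bound (HasDegree-* e deg) b) (ℕ.≤⇒≯ (ℕ.m≤n+m d m))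

    bounded∼0 : ∀ {r} → Bounded d r → r ∼ [] → r ≋ []
    bounded∼0 b (modulo q e) = ≋-trans e (*P-nullˡ {q} h (bounded-multiple q (Bounded-resp e b)))

    _∼?_ : ∀ p q → Dec (p ∼ q)
    p ∼? q with remainder (p -P q)
    ... | r , p-q∼r , b with degree? r
    ...   | inj₁ r≋0     = yes (RingLemmas.diff≈0⇒≈ quotientRing (∼-trans p-q∼r (≈⇒∼ r≋0)))
    ...   | inj₂ (m , e) = no λ p∼q → HasDegree≢0 e (bounded∼0 b
              (∼-trans (∼-sym p-q∼r) (RingLemmas.≈⇒diff≈0 quotientRing p∼q)))

    -- Taken at the degree of `h`, these lists represent every residue class, so the residue ring is
    -- finite.
    residues : ℕ → List Poly
    residues zero    = [] ∷ []
    residues (suc n) = cartesianProductWith _∷_ elements (residues n)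

    tail : Poly → Poly
    tail []      = []
    tail (a ∷ p) = p

    ∷-tail : ∀ p → p ≋ coeff p 0 ∷ tail p
    ∷-tail []      = ≋-sym 0∷[]≋[]
    ∷-tail (a ∷ p) = ≋-refl

    residues-complete : ∀ n p → Bounded n p → ∃ λ p′ → p′ ∈ residues n × p ≋ p′
    residues-complete zero    p b = [] , here ≡.refl , Bounded-0 b
    residues-complete (suc n) p b with residues-complete n (tail p) (Bounded-tail (Bounded-resp (∷-tail p) b))
    ... | p′ , p′∈ , e = coeff p 0 ∷ p′ , ∈-cartesianProductWith⁺ _∷_ (complete (coeff p 0)) p′∈
          , ≋-trans (∷-tail p) (∷-cong ≡.refl e)

    quotient-complete : ∀ p → Any (p ∼_) (residues d)
    quotient-complete p with remainder p
    ... | r , p∼r , b with residues-complete d r b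
    ...   | p′ , p′∈ , e = Any.map (λ { ≡.refl → ∼-trans p∼r (≈⇒∼ e) }) p′∈

  record GCD (p h : Poly) : Set c where
    field
      divisor bezoutˡ bezoutʳ cofactorˡ cofactorʳ : Poly
      bezout   : divisor ≋ bezoutˡ *P p +P bezoutʳ *P h
      dividesˡ : p ≋ cofactorˡ *P divisor
      dividesʳ : h ≋ cofactorʳ *P divisor

  gcd-zero : ∀ {p h} → p ≋ [] → GCD p h
  gcd-zero {p} {h} e = record
    { divisor = h ; bezoutˡ = [] ; bezoutʳ = const 1# ; cofactorˡ = [] ; cofactorʳ = const 1#
    ; bezout = ≋-sym (*P-identityˡ h) ; dividesˡ = e ; dividesʳ = ≋-sym (*P-identityˡ h) }

  -- Euclid's algorithm replaces (p, h) by (h mod p, p). The argument `n` bounds the first entry,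
  -- which drops each time, and makes the recursion structural.
  gcd : ∀ n p h → Bounded n p → GCD p h
  gcd zero    p h b = gcd-zero (Bounded-0 b)
  gcd (suc n) p h b with degree? p
  ... | inj₁ p≋0     = gcd-zero p≋0
  ... | inj₂ (m , d) with Division.remainder p d h
  ...   | r , QuotientRing.modulo q e , b′ = record
        { divisor = divisor ; bezoutˡ = bezoutʳ -P bezoutˡ *P q ; bezoutʳ = bezoutˡ
        ; cofactorˡ = cofactorʳ ; cofactorʳ = cofactorˡ +P q *P cofactorʳ
        ; bezout = ≋-trans bezout (≋-trans
            (bezout-step bezoutˡ bezoutʳ r q p)
            (+P-cong {(bezoutʳ -P bezoutˡ *P q) *P p} ≋-refl (*P-congˡ bezoutˡ (≋-sym e))))
        ; dividesˡ = dividesʳ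
        ; dividesʳ = ≋-trans e (≋-trans (+P-cong dividesˡ (*P-congˡ q dividesʳ))
            (cofactor-step cofactorˡ q cofactorʳ divisor)) }
    where
    open GCD (gcd n r p (Bounded-≤ (ℕ.s≤s⁻¹ (HasDegree<bound d b)) b′))

  coeff-normalize : ∀ p i → coeff (normalize p) i ≡ coeff p i
  coeff-normalize []      i = ≡.refl
  coeff-normalize (a ∷ p) i with normalize p | coeff-normalize p
  ... | b ∷ r | eq with i
  ...   | zero  = ≡.refl
  ...   | suc j = eq j
  coeff-normalize (a ∷ p) i | [] | eq with a ≟ 0#
  coeff-normalize (a ∷ p) zero    | [] | eq | yes a≡0 = ≡.sym a≡0
  coeff-normalize (a ∷ p) (suc i) | [] | eq | yes a≡0 = eq i
  coeff-normalize (a ∷ p) zero    | [] | eq | no  _   = ≡.refl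
  coeff-normalize (a ∷ p) (suc i) | [] | eq | no  _   = eq i

  Bounded-length : ∀ p → Bounded (length p) p
  Bounded-length []      = bounded λ _ _ → ≡.refl
  Bounded-length (a ∷ p) = Bounded-∷ a (Bounded-length p)

  Bounded-degree : ∀ p → Bounded (suc (degree p)) p
  Bounded-degree p = Bounded-resp (coeffwise (coeff-normalize p))
    (Bounded-≤ (ℕ.m≤n+m∸n (length (normalize p)) 1) (Bounded-length (normalize p)))

  Monic⇒HasDegree : ∀ p → Monic p → HasDegree (degree p) p
  Monic⇒HasDegree p monic = hasDegree (λ e → 0≢1 (≡.trans (≡.sym e) monic)) (Bounded-degree p)

  degree0⇒const : ∀ p → degree p ≡ 0 → p ≋ const (coeff p 0)
  degree0⇒const p e = Bounded-1 (≡.subst (λ n → Bounded (suc n) p) e (Bounded-degree p))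

  module ResidueField {d} (h : Poly) (deg : HasDegree d h) (irreducible : Irreducible h) where
    open QuotientRing polynomialRing h public
    open Division h deg public

    const-inverse : ∀ {a} → ¬ (a ≡ 0#) → ∃ λ b → const a *P b ≋ const 1#
    const-inverse {a} a≢0 with inverse a a≢0
    ... | b , inv = const b , coeffwise λ { zero → ≡.trans (+-identityʳ _) inv ; (suc i) → ≡.refl }

    const-0 : ∀ {a} → a ≡ 0# → const a ≋ []
    const-0 z = ≋-trans (∷-cong z ≋-refl) 0∷[]≋[]

    associate : ∀ {p A B D} b → p ≋ A *P D → h ≋ B *P D → B ≋ const b → p ∼ []
    associate {p} {A} {B} {D} b p≋ h≋ B≋ with b ≟ 0#
    ... | yes z  = contradiction (≋-trans h≋ (*P-nullˡ {B} D (≋-trans B≋ (const-0 z)))) (HasDegree≢0 deg)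
    ... | no  nz with const-inverse nz
    ...   | e , inv = modulo (A *P e) (≋-trans p≋ (≋-trans
            (*P-congˡ A (≋-sym (≋-trans (*P-congʳ D inv) (*P-identityˡ D)))) (≋-trans
            (regroup A e (const b) D)
            (*P-congˡ (A *P e) (≋-sym (≋-trans h≋ (*P-congʳ D B≋)))))))

    coprime : ∀ {p U V B D} b → D ≋ U *P p +P V *P h → h ≋ B *P D → D ≋ const b → ∃ λ q → p *P q ∼ const 1#
    coprime {p} {U} {V} {B} {D} b bez h≋ D≋ with b ≟ 0#
    ... | yes z  = contradiction (≋-trans h≋ (≋-trans (*P-congˡ B (≋-trans D≋ (const-0 z))) (*P-zeroʳ B))) (HasDegree≢0 deg)
    ... | no  nz with const-inverse nz
    ...   | e , inv = U *P e , modulo (negP (V *P e)) (≋-trans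
            (inverse-modulo p U e V h)
            (+P-cong (≋-trans (*P-congʳ e (≋-trans (≋-sym bez) D≋)) inv) ≋-refl))

    abstract
      -- Irreducibility applies to the factorisation of h as cofactor times gcd. A constant cofactor
      -- makes h divide p; a constant gcd turns the Bézout relation into an inverse of p.
      zero-or-unit : RingLemmas.ZeroOrUnit quotientRing
      zero-or-unit p with gcd (length p) p h (Bounded-length p)
      ... | G with proj₂ irreducible (GCD.cofactorʳ G) (GCD.divisor G) (at (≋-sym (GCD.dividesʳ G)))
      ...   | inj₁ e = inj₁ (associate {A = GCD.cofactorˡ G} {B = GCD.cofactorʳ G} _ (GCD.dividesˡ G) (GCD.dividesʳ G) (degree0⇒const _ e))
      ...   | inj₂ e = inj₂ (coprime {U = GCD.bezoutˡ G} {V = GCD.bezoutʳ G} {B = GCD.cofactorʳ G} _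
              (GCD.bezout G) (GCD.dividesʳ G) (degree0⇒const _ e))

-- Values at points, infinite descent and Thue's lemma.

module FieldEvaluation {c} (F : FiniteField c) where
  open FiniteField F hiding (_*_) renaming (Carrier to 𝔽)
  open FiniteField F using () renaming (_*_ to _·_)
  open FieldDefs F
  open PolynomialRing F
  open PolynomialDegree F
  open CommutativeRing fieldRing using (_-_; +-identityʳ; -‿inverseʳ; *-identityʳ; zeroˡ)
  open RingProperties (CommutativeRing.ring fieldRing) using (-‿involutive; -0#≈0#)
  open RingLemmas polynomialRing using (cancelˡ; synthetic-division-step; square-of-product; scaled-square-of-product)

  module _ (a : 𝔽) where
    open Evaluation.At F fieldRing id (λ _ _ → ≡.refl) (λ _ _ → ≡.refl) ≡.refl ≡.refl
      (λ p → eval p a) a ≡.refl (λ _ _ → ≡.refl) public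
      using () renaming (evalA-cong to eval-cong; evalA-+ to eval-+; evalA-* to eval-*; evalA-const to eval-const; evalA-X to eval-X; evalA-neg to eval-neg)

  eval-- : ∀ x p q → eval (p -P q) x ≡ eval p x - eval q x
  eval-- x p q = ≡.trans (eval-+ x p (negP q)) (≡.cong (λ z → eval p x + z) (eval-neg x q))

  -- Opaque, so that the conversion checker does not unfold products with it.
  abstract
    [_-X] : 𝔽 → Poly
    [ a -X] = const a -P X

    [-X]≋ : ∀ a → [ a -X] ≋ const a -P X
    [-X]≋ a = ≋-refl

    eval-[-X] : ∀ a x → eval [ a -X] x ≡ a - x
    eval-[-X] a x = ≡.trans (eval-- x (const a) X) (≡.cong₂ _-_ (eval-const x a) (eval-X x))

    eval-root : ∀ a → eval [ a -X] a ≡ 0#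
    eval-root a = ≡.trans (eval-[-X] a a) (-‿inverseʳ a)

    coeff-[-X] : ∀ a → coeff [ a -X] 1 ≡ - 1#
    coeff-[-X] a = *-identityʳ (- 1#)

    [-X]-HasDegree : ∀ a → HasDegree 1 [ a -X]
    [-X]-HasDegree a = hasDegree
      (λ e → 0≢1 (≡.trans (≡.sym -0#≈0#) (≡.trans (≡.cong -_ (≡.trans (≡.sym e) (coeff-[-X] a))) (-‿involutive 1#))))
      (Bounded-∷ _ (Bounded-∷ _ (bounded λ _ _ → ≡.refl)))

  [-X]-cancelˡ : ∀ a {p q} → [ a -X] *P p ≋ [ a -X] *P q → p ≋ q
  [-X]-cancelˡ a = cancelˡ polynomial-domain (HasDegree≢0 ([-X]-HasDegree a))

  divide-root : ∀ a p → ∃ λ q → p ≋ const (eval p a) +P (const a -P X) *P q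
  divide-root a []      = [] , ≋-trans (≋-sym 0∷[]≋[]) (≋-sym (≋-trans (+P-cong {const 0#} ≋-refl (*P-zeroʳ (const a -P X))) (+P-identityʳ _)))
  divide-root a (b ∷ p) with divide-root a p
  ... | q , e = X *P q -P const (eval p a) , ≋-trans (∷≋ b p) (≋-trans (+P-cong {const b} ≋-refl (*P-congˡ X e)) (≋-trans
      (synthetic-division-step (const b) X (const a) (const (eval p a)) q)
      (+P-cong {const b +P const a *P const (eval p a)} {r = (const a -P X) *P (X *P q -P const (eval p a))} (∷-cong (≡.cong (b +_) (+-identityʳ _)) ≋-refl) ≋-refl)))

  abstract
    factor-root : ∀ a p → eval p a ≡ 0# → ∃ λ q → p ≋ [ a -X] *P q
    factor-root a p z with divide-root a p
    ... | q , e = q , ≋-trans e (+P-cong (≋-trans (∷-cong z ≋-refl) 0∷[]≋[]) (*P-congʳ q (≋-sym ([-X]≋ a))))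

  module _ (a : 𝔽) (B V W : Poly) where

    -- First half of a descent step: the factor a - X changes sides. `divide-right` moves it back,
    -- and (V₁, W₁) satisfies the relation of (V, W).
    divide-left : ∀ {W₁} → W ≋ [ a -X] *P W₁ → W *P W ≋ ([ a -X] *P B) *P (V *P V) → [ a -X] *P (W₁ *P W₁) ≋ B *P (V *P V)
    divide-left {W₁} W≋ rel = [-X]-cancelˡ a {[ a -X] *P (W₁ *P W₁)} {B *P (V *P V)} (begin
      [ a -X] *P ([ a -X] *P (W₁ *P W₁))   ≈⟨ square-of-product [ a -X] W₁ ⟨
      ([ a -X] *P W₁) *P ([ a -X] *P W₁)   ≈⟨ *P-cong W≋ W≋ ⟨
      W *P W                               ≈⟨ rel ⟩
      ([ a -X] *P B) *P (V *P V)           ≈⟨ *P-assoc [ a -X] B (V *P V) ⟩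
      [ a -X] *P (B *P (V *P V))           ∎)
      where open SetoidReasoning (CommutativeRing.setoid polynomialRing)

    divide-right : ∀ {U V₁} → V ≋ [ a -X] *P V₁ → [ a -X] *P U ≋ B *P (V *P V) → U ≋ ([ a -X] *P B) *P (V₁ *P V₁)
    divide-right {U} {V₁} V≋ rel = [-X]-cancelˡ a {U} {([ a -X] *P B) *P (V₁ *P V₁)} (begin
      [ a -X] *P U                                   ≈⟨ rel ⟩
      B *P (V *P V)                                  ≈⟨ *P-congˡ B (*P-cong V≋ V≋) ⟩
      B *P (([ a -X] *P V₁) *P ([ a -X] *P V₁))      ≈⟨ scaled-square-of-product B [ a -X] V₁ ⟩
      [ a -X] *P (([ a -X] *P B) *P (V₁ *P V₁))      ∎)
      where open SetoidReasoning (CommutativeRing.setoid polynomialRing)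

    root-left : W *P W ≋ ([ a -X] *P B) *P (V *P V) → eval W a ≡ 0#
    root-left rel = RingLemmas.square-zero fieldRing field-domain (begin
      eval W a · eval W a                              ≡⟨ eval-* a W W ⟨
      eval (W *P W) a                                  ≡⟨ eval-cong a rel ⟩
      eval (([ a -X] *P B) *P (V *P V)) a              ≡⟨ eval-* a ([ a -X] *P B) (V *P V) ⟩
      eval ([ a -X] *P B) a · eval (V *P V) a          ≡⟨ ≡.cong (_· eval (V *P V) a) (eval-* a [ a -X] B) ⟩
      eval [ a -X] a · eval B a · eval (V *P V) a      ≡⟨ ≡.cong (λ z → z · eval B a · eval (V *P V) a) (eval-root a) ⟩
      0# · eval B a · eval (V *P V) a                  ≡⟨ ≡.cong (_· eval (V *P V) a) (zeroˡ _) ⟩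
      0# · eval (V *P V) a                             ≡⟨ zeroˡ _ ⟩
      0#                                               ∎)
      where open ≡.≡-Reasoning

    -- The left side vanishes at a and B does not, so V(a)² = 0. This is where it matters that a is
    -- a simple root of (a - X) B.
    root-right : ∀ {U} → ¬ (eval B a ≡ 0#) → [ a -X] *P U ≋ B *P (V *P V) → eval V a ≡ 0#
    root-right {U} B≢0 rel = RingLemmas.square-zero fieldRing field-domain
      (fromInj₂ (λ z → contradiction z B≢0) (field-domain (eval B a) (eval V a · eval V a) (begin
      eval B a · (eval V a · eval V a)     ≡⟨ ≡.cong (eval B a ·_) (eval-* a V V) ⟨
      eval B a · eval (V *P V) a           ≡⟨ eval-* a B (V *P V) ⟨
      eval (B *P (V *P V)) a               ≡⟨ eval-cong a rel ⟨
      eval ([ a -X] *P U) a                ≡⟨ eval-* a [ a -X] U ⟩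
      eval [ a -X] a · eval U a            ≡⟨ ≡.cong (_· eval U a) (eval-root a) ⟩
      0# · eval U a                        ≡⟨ zeroˡ _ ⟩
      0#                                   ∎)))
      where open ≡.≡-Reasoning

  degree-cofactor : ∀ {l a V V₁} → HasDegree l V → V ≋ [ a -X] *P V₁ → ∃ λ m → l ≡ suc m × HasDegree m V₁
  degree-cofactor {l} {a} {V} {V₁} degV V≋ with degree? V₁
  ... | inj₁ z       = contradiction (≋-trans V≋ (≋-trans (*P-congˡ [ a -X] z) (*P-zeroʳ [ a -X]))) (HasDegree≢0 degV)
  ... | inj₂ (m , d) = m , HasDegree-unique degV (HasDegree-resp (≋-sym V≋) (HasDegree-* ([-X]-HasDegree a) d)) , d

  -- Infinite descent: a - X divides W and then V, and both can be divided out.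
  no-square-relation : ∀ l a B V W → ¬ (eval B a ≡ 0#) → HasDegree l V → ¬ (W *P W ≋ ([ a -X] *P B) *P (V *P V))
  no-square-relation l a B V W B≢0 degV rel with factor-root a W (root-left a B V W rel)
  ... | W₁ , W≋ with factor-root a V (root-right a B V W B≢0 (divide-left a B V W W≋ rel))
  ...   | V₁ , V≋ with degree-cofactor degV V≋
  ...     | m , ≡.refl , degV₁ = no-square-relation m a B V₁ W₁ B≢0 degV₁ (divide-right a B V W V≋ (divide-left a B V W W≋ rel))

-- Thue's lemma: pairs (V, W) with V of low degree and W ≡ S V of low degree modulo h.
-- The pairs have strictly increasing degrees in V, so subtracting a multiple of one pair from a later one
-- to lower the bound on W never destroys the degree of V.
module SmallSolutions {c} (F : FiniteField c) {d} (h : FieldDefs.Poly F)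
                      (deg : PolynomialDegree.HasDegree F d h) (S : FieldDefs.Poly F) where
  open FieldDefs F
  open FiniteField F hiding (_*_) renaming (Carrier to 𝔽)
  open FiniteField F using () renaming (_*_ to _·_)
  open PolynomialRing F
  open PolynomialDegree F
  open QuotientRing polynomialRing h
  open CommutativeRing fieldRing using (-‿inverseʳ; +-identityʳ; *-assoc; *-comm; *-identityʳ; zeroʳ)
  open RingProperties (CommutativeRing.ring fieldRing) using (-0#≈0#)

  record Solution (bnd k : ℕ) : Set c where
    field
      V W       : Poly
      V-degree  : HasDegree k V
      W-bounded : Bounded bnd W
      W∼SV      : W ∼ S *P V
  open Solution

  -- The last index counts the pairs. The degrees of their V increase strictly within the range from
  -- m to below v, and all their W have degree below `bnd`.
  data Staircase (bnd v : ℕ) : ℕ → ℕ → Set c where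
    []   : ∀ {m} → Staircase bnd v m 0
    step : ∀ {m n k} → m ≤ k → k < v → Solution bnd k → Staircase bnd v (suc k) n → Staircase bnd v m (suc n)

  raise : ∀ {bnd v m m′ n} → m ≤ m′ → Staircase bnd v m′ n → Staircase bnd v m n
  raise le []                = []
  raise le (step m≤k k<v s r) = step (ℕ.≤-trans le m≤k) k<v s r

  combine : ∀ {bnd j k} → Solution (suc bnd) j → (s : Solution (suc bnd) k) → k < j → ¬ (coeff (W s) bnd ≡ 0#) →
    Solution bnd j
  combine {bnd} {j} {k} t s k<j W≢0 with inverse (coeff (W s) bnd) W≢0
  ... | w⁻¹ , inv = record
    { V = V t -P const a *P V s
    ; W = W t -P const a *P W s
    ; V-degree = hasDegree (λ e → leading≢0 (V-degree t) (≡.trans (≡.sym V-top) e))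
        (Bounded-- (bound (V-degree t)) (Bounded-≤ (ℕ.m≤n⇒m≤1+n k<j) (Bounded-const-* a (bound (V-degree s)))))
    ; W-bounded = Bounded-pred W-top (Bounded-- (W-bounded t) (Bounded-const-* a (W-bounded s)))
    ; W∼SV = ∼-trans (∼-+-cong (W∼SV t) (∼-neg-cong (∼-*-cong (≈⇒∼ (≋-refl {const a})) (W∼SV s))))
        (≈⇒∼ (≋-sym (RingLemmas.factor-out polynomialRing S (V t) (const a) (V s)))) }
    where
    a = coeff (W t) bnd · w⁻¹
    open ≡.≡-Reasoning
    V-top : coeff (V t -P const a *P V s) j ≡ coeff (V t) j
    V-top = begin
      coeff (V t -P const a *P V s) j           ≡⟨ coeff-- (V t) (const a *P V s) j ⟩
      coeff (V t) j + - coeff (const a *P V s) j ≡⟨ ≡.cong (λ z → coeff (V t) j + - z)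
        (≡.trans (coeff-const-* a (V s) j) (≡.trans (≡.cong (a ·_) (beyond (bound (V-degree s)) j k<j)) (zeroʳ a))) ⟩
      coeff (V t) j + - 0#                      ≡⟨ ≡.cong (coeff (V t) j +_) -0#≈0# ⟩
      coeff (V t) j + 0#                        ≡⟨ +-identityʳ _ ⟩
      coeff (V t) j                             ∎
    W-top : coeff (W t -P const a *P W s) bnd ≡ 0#
    W-top = begin
      coeff (W t -P const a *P W s) bnd             ≡⟨ coeff-- (W t) (const a *P W s) bnd ⟩
      coeff (W t) bnd + - coeff (const a *P W s) bnd ≡⟨ ≡.cong (λ z → coeff (W t) bnd + - z) (≡.trans (coeff-const-* a (W s) bnd)
        (≡.trans (*-assoc _ _ _) (≡.trans (≡.cong (coeff (W t) bnd ·_) (≡.trans (*-comm _ _) inv)) (*-identityʳ _)))) ⟩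
      coeff (W t) bnd + - coeff (W t) bnd           ≡⟨ -‿inverseʳ _ ⟩
      0#                                            ∎

  combineAll : ∀ {bnd v m n k} (s : Solution (suc bnd) k) → k < m → ¬ (coeff (W s) bnd ≡ 0#) →
    Staircase (suc bnd) v m n → Staircase bnd v m n
  combineAll s k<m W≢0 []                 = []
  combineAll s k<m W≢0 (step m≤j j<v t r) = step m≤j j<v (combine t s (ℕ.<-≤-trans k<m m≤j) W≢0)
    (combineAll s (ℕ.<-≤-trans k<m (ℕ.m≤n⇒m≤1+n m≤j)) W≢0 r)

  -- Gaussian elimination of one coefficient. The first pair whose W reaches degree `bnd` is the
  -- pivot: the pairs before it are clean already, those after it are cleared by it, and it is given
  -- up.
  lower : ∀ {bnd v m n} → Staircase (suc bnd) v m (suc n) → Staircase bnd v m n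
  lower {bnd} (step m≤k k<v s r) with coeff (W s) bnd ≟ 0#
  ... | no  W≢0 = raise (ℕ.m≤n⇒m≤1+n m≤k) (combineAll s (ℕ.n<1+n _) W≢0 r)
  -- If no pivot has occurred, the last pair is given up, so the count drops by one in every case.
  lower {n = zero}  (step m≤k k<v s r) | yes W≡0 = []
  lower {n = suc n} (step m≤k k<v s r) | yes W≡0 = step m≤k k<v
    (record { V = V s ; W = W s ; V-degree = V-degree s ; W-bounded = Bounded-pred W≡0 (W-bounded s) ; W∼SV = W∼SV s }) (lower r)

  lowerAll : ∀ n {bnd v m} → Staircase (n ℕ.+ bnd) v m (suc n) → Staircase bnd v m 1
  lowerAll zero    s = s
  lowerAll (suc n) s = lowerAll n (lower s)

  monomial : ℕ → Poly
  monomial zero    = const 1#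
  monomial (suc k) = 0# ∷ monomial k

  monomial-HasDegree : ∀ k → HasDegree k (monomial k)
  monomial-HasDegree zero    = hasDegree (0≢1 ∘ ≡.sym) (Bounded-∷ 1# (bounded λ _ _ → ≡.refl))
  monomial-HasDegree (suc k) = hasDegree (leading≢0 (monomial-HasDegree k)) (Bounded-∷ 0# (bound (monomial-HasDegree k)))

  monomials : ∀ m n → Staircase d (m ℕ.+ n) m n
  monomials m zero    = []
  monomials m (suc n) with Division.remainder h deg (S *P monomial m)
  ... | r , SX∼r , b = step ℕ.≤-refl (ℕ.m<m+n m (s≤s z≤n))
    (record { V = monomial m ; W = r ; V-degree = monomial-HasDegree m ; W-bounded = b ; W∼SV = ∼-sym SX∼r })
    (≡.subst (λ v → Staircase d v (suc m) n) (≡.sym (ℕ.+-suc m n)) (monomials (suc m) n))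

  -- There are n + 1 monomials to start from and n coefficients of W to eliminate, so one pair
  -- survives. Its V has a degree and is therefore nonzero.
  small-solution : ∀ n bnd → d ≡ n ℕ.+ bnd → ∃ λ k → k ≤ n × Solution bnd k
  small-solution n bnd eq with lowerAll n (≡.subst (λ e → Staircase e (suc n) 0 (suc n)) eq (monomials 0 (suc n)))
  ... | step {k = k} _ k<1+n s [] = k , ℕ.s≤s⁻¹ k<1+n , s

-- From square classes modulo h to square values of h.

module Reciprocity {c} (F : FiniteField c) {d} (h : FieldDefs.Poly F) (deg : PolynomialDegree.HasDegree F d h)
                   (monic : FieldDefs.coeff F h d ≡ FiniteField.1# F) where
  open FieldDefs F
  open FiniteField F hiding (_*_) renaming (Carrier to 𝔽)
  open FiniteField F using () renaming (_*_ to _·_)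
  open PolynomialRing F
  open PolynomialDegree F
  open FieldEvaluation F
  open QuotientRing polynomialRing h
  open CommutativeRing fieldRing using (_-_; -‿inverseʳ; +-identityˡ; +-identityʳ; *-identityʳ; zeroˡ)
  open RingProperties (CommutativeRing.ring fieldRing) using (-0#≈0#; -1*x≈-x; -‿involutive)
  open RingLemmas quotientRing using () renaming (Square to SquareModulo)
  open ≡.≡-Reasoning

  -- As `h` is monic, subtracting the multiple by the top coefficient leaves a multiple of `h` of
  -- degree below d, which must be zero.
  constant-multiple : ∀ D → Bounded (suc d) D → D ∼ [] → D ≋ const (coeff D d) *P h
  constant-multiple D b (modulo q e) = RingLemmas.diff≈0⇒≈ polynomialRing
    (Division.bounded∼0 h deg (Bounded-pred top (Bounded-- b (Bounded-const-* l (bound deg))))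
      (modulo (q -P const l) (≋-trans (+P-cong e ≋-refl) (RingLemmas.minus-factor polynomialRing q h (const l)))))
    where
    l = coeff D d
    top : coeff (D -P const l *P h) d ≡ 0#
    top = begin
      coeff (D -P const l *P h) d      ≡⟨ coeff-- D (const l *P h) d ⟩
      l - coeff (const l *P h) d       ≡⟨ ≡.cong (λ z → l - z) (≡.trans (coeff-const-* l h d) (≡.trans (≡.cong (l ·_) monic) (*-identityʳ l))) ⟩
      l - l                            ≡⟨ -‿inverseʳ l ⟩
      0#                               ∎

  -- `norm` is the norm of W + V √A, and its coefficient at d is the scalar by which it differs from
  -- `h`.
  record NormEquation (n bnd : ℕ) (A : Poly) : Set c where
    field
      V W       : Poly
      V-bounded : Bounded (suc n) V
      W-bounded : Bounded bnd W
    norm : Poly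
    norm = W *P W -P A *P (V *P V)
    field
      norm≋     : norm ≋ const (coeff norm d) *P h
      scalar≢0  : ¬ (coeff norm d ≡ 0#)

  -- Modulo h, W² ≡ S² V² ≡ A V². A zero scalar would make A V² equal to W², which the descent at
  -- the simple root a of A excludes.
  norm-equation : ∀ n bnd → d ≡ n ℕ.+ bnd → ∀ a B → ¬ (eval B a ≡ 0#) → SquareModulo ([ a -X] *P B) →
    (∀ V W → Bounded (suc n) V → Bounded bnd W → Bounded (suc d) (W *P W -P ([ a -X] *P B) *P (V *P V))) →
    NormEquation n bnd ([ a -X] *P B)
  norm-equation n bnd eq a B B≢0 (S , SS∼A) norm-bounded with SmallSolutions.small-solution F h deg S n bnd eq
  ... | k , k≤n , solution = record
    { V = V ; W = W ; V-bounded = V-bounded ; W-bounded = W-bounded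
    ; norm≋ = norm≋
    ; scalar≢0 = λ z → no-square-relation k a B V W B≢0 V-degree (RingLemmas.diff≈0⇒≈ polynomialRing
        (≋-trans norm≋ (*P-nullˡ h (≋-trans (∷-cong z ≋-refl) 0∷[]≋[])))) }
    where
    open SmallSolutions.Solution solution
    V-bounded = Bounded-≤ (s≤s k≤n) (bound V-degree)
    norm≋ = constant-multiple (W *P W -P ([ a -X] *P B) *P (V *P V)) (norm-bounded V W V-bounded W-bounded)
      (RingLemmas.≈⇒diff≈0 quotientRing (∼-trans (∼-*-cong W∼SV W∼SV)
        (∼-trans (≈⇒∼ (RingLemmas.interchange-squares polynomialRing S V)) (∼-*-cong SS∼A (≈⇒∼ ≋-refl)))))

  -- At a root of A only W² survives in the norm.
  value-square : ∀ {n bnd A} a → eval A a ≡ 0# → (E : NormEquation n bnd A) → let open NormEquation E in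
    eval h a · coeff norm d ≡ eval W a · eval W a
  value-square {A = A} a root E = begin
    eval h a · e                           ≡⟨ CommutativeRing.*-comm fieldRing _ _ ⟩
    e · eval h a                           ≡⟨ ≡.cong (_· eval h a) (eval-const a e) ⟨
    eval (const e) a · eval h a            ≡⟨ eval-* a (const e) h ⟨
    eval (const e *P h) a                  ≡⟨ eval-cong a norm≋ ⟨
    eval norm a                            ≡⟨ eval-- a (W *P W) (A *P (V *P V)) ⟩
    eval (W *P W) a - eval (A *P (V *P V)) a ≡⟨ ≡.cong₂ _-_ (eval-* a W W)
      (≡.trans (eval-* a A (V *P V)) (≡.trans (≡.cong (_· eval (V *P V) a) root) (zeroˡ _))) ⟩
    eval W a · eval W a - 0#               ≡⟨ ≡.trans (≡.cong (eval W a · eval W a +_) -0#≈0#) (+-identityʳ _) ⟩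
    eval W a · eval W a                    ∎
    where
    open NormEquation E
    e = coeff norm d

  square-value : ∀ {a v w} → ¬ (v · v ≡ 0#) → eval h a · (v · v) ≡ w · w → IsSquare (eval h a)
  square-value {v = v} vv≢0 p with inverse v (λ z → vv≢0 (≡.trans (≡.cong (_· v) z) (zeroˡ v)))
  ... | v⁻¹ , inv = RingLemmas.square-quotient fieldRing inv p

  root-product : ∀ a B → eval ([ a -X] *P B) a ≡ 0#
  root-product a B = ≡.trans (eval-* a [ a -X] B) (≡.trans (≡.cong (_· eval B a) (eval-root a)) (zeroˡ _))

  -- With deg V at most k and deg W at most k + 1, the term A V² stays below degree d = 2k + 2, so
  -- the scalar is the square of the top coefficient of W. The factor b does not affect this, which
  -- opens the lemma to scalar multiples of a - x.
  linear-even : ∀ k → d ≡ suc k ℕ.+ suc k → ∀ a b → ¬ (b ≡ 0#) → SquareModulo ([ a -X] *P const b) → IsSquare (eval h a)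
  linear-even k eq a b b≢0 square = square-value (λ z → scalar≢0 (≡.trans scalar≡ z))
      (≡.trans (≡.cong (eval h a ·_) (≡.sym scalar≡)) (value-square a (root-product a (const b)) E))
    where
    A-bounded : Bounded 2 ([ a -X] *P const b)
    A-bounded = Bounded-* [ a -X] (const b) (bound ([-X]-HasDegree a)) (Bounded-∷ b (bounded λ _ _ → ≡.refl))
    AVV-bounded : ∀ V → Bounded (suc k) V → Bounded d (([ a -X] *P const b) *P (V *P V))
    AVV-bounded V Vb = ≡.subst (λ m → Bounded m (([ a -X] *P const b) *P (V *P V))) (≡.sym (≡.trans eq (≡.cong suc (ℕ.+-suc k k))))
      (Bounded-* ([ a -X] *P const b) (V *P V) A-bounded (Bounded-* V V Vb Vb))
    WW-bounded : ∀ W → Bounded (suc (suc k)) W → Bounded (suc d) (W *P W)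
    WW-bounded W Wb = ≡.subst (λ m → Bounded (suc m) (W *P W)) (≡.sym eq) (Bounded-* W W Wb Wb)
    E = norm-equation k (suc (suc k)) (≡.trans eq (≡.sym (ℕ.+-suc k (suc k)))) a (const b)
      (λ z → b≢0 (≡.trans (≡.sym (eval-const a b)) z)) square
      (λ V W Vb Wb → Bounded-- (WW-bounded W Wb) (Bounded-≤ (ℕ.n≤1+n d) (AVV-bounded V Vb)))
    open NormEquation E
    scalar≡ : coeff norm d ≡ coeff W (suc k) · coeff W (suc k)
    scalar≡ = begin
      coeff norm d                                      ≡⟨ coeff-- (W *P W) _ d ⟩
      coeff (W *P W) d - coeff (([ a -X] *P const b) *P (V *P V)) d ≡⟨ ≡.cong₂ _-_
        (≡.trans (≡.cong (coeff (W *P W)) eq) (coeff-* W W W-bounded W-bounded)) (beyond (AVV-bounded V V-bounded) d ℕ.≤-refl) ⟩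
      coeff W (suc k) · coeff W (suc k) - 0#            ≡⟨ ≡.trans (≡.cong (coeff W (suc k) · coeff W (suc k) +_) -0#≈0#) (+-identityʳ _) ⟩
      coeff W (suc k) · coeff W (suc k)                 ∎

  -- Here deg V and deg W are at most k, and A V² alone reaches degree d = 2k + 1. The leading
  -- coefficient - 1 of a - X cancels the sign of the norm, so the scalar is the square of the top
  -- coefficient of V.
  linear-odd : ∀ k → d ≡ suc (k ℕ.+ k) → ∀ a → SquareModulo ([ a -X] *P const 1#) → IsSquare (eval h a)
  linear-odd k eq a square = square-value (λ z → scalar≢0 (≡.trans scalar≡ z))
      (≡.trans (≡.cong (eval h a ·_) (≡.sym scalar≡)) (value-square a (root-product a (const 1#)) E))
    where
    A = [ a -X] *P const 1#
    1-bounded : Bounded 1 (const 1#)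
    1-bounded = Bounded-∷ 1# (bounded λ _ _ → ≡.refl)
    A-bounded : Bounded 2 A
    A-bounded = Bounded-* [ a -X] (const 1#) (bound ([-X]-HasDegree a)) 1-bounded
    AVV-bounded : ∀ V → Bounded (suc k) V → Bounded (suc d) (A *P (V *P V))
    AVV-bounded V Vb = ≡.subst (λ m → Bounded (suc m) (A *P (V *P V))) (≡.sym eq)
      (Bounded-* A (V *P V) A-bounded (Bounded-* V V Vb Vb))
    WW-bounded : ∀ W → Bounded (suc k) W → Bounded d (W *P W)
    WW-bounded W Wb = ≡.subst (λ m → Bounded m (W *P W)) (≡.sym eq) (Bounded-* W W Wb Wb)
    E = norm-equation k (suc k) (≡.trans eq (≡.sym (ℕ.+-suc k k))) a (const 1#)
      (λ z → 0≢1 (≡.sym (≡.trans (≡.sym (eval-const a 1#)) z))) square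
      (λ V W Vb Wb → Bounded-- (Bounded-≤ (ℕ.n≤1+n d) (WW-bounded W Wb)) (AVV-bounded V Vb))
    open NormEquation E
    scalar≡ : coeff norm d ≡ coeff V k · coeff V k
    scalar≡ = begin
      coeff norm d                                      ≡⟨ coeff-- (W *P W) _ d ⟩
      coeff (W *P W) d - coeff (A *P (V *P V)) d        ≡⟨ ≡.cong₂ _-_ (beyond (WW-bounded W W-bounded) d ℕ.≤-refl)
        (≡.trans (≡.cong (coeff (A *P (V *P V))) eq) (coeff-* A (V *P V) A-bounded (Bounded-* V V V-bounded V-bounded))) ⟩
      0# - coeff A 1 · coeff (V *P V) (k ℕ.+ k)         ≡⟨ +-identityˡ _ ⟩
      - (coeff A 1 · coeff (V *P V) (k ℕ.+ k))          ≡⟨ ≡.cong₂ (λ x y → - (x · y))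
        (≡.trans (coeff-* [ a -X] (const 1#) (bound ([-X]-HasDegree a)) 1-bounded) (≡.trans (*-identityʳ _) (coeff-[-X] a)))
        (coeff-* V V V-bounded V-bounded) ⟩
      - ((- 1#) · (coeff V k · coeff V k))              ≡⟨ ≡.trans (≡.cong -_ (-1*x≈-x _)) (-‿involutive _) ⟩
      coeff V k · coeff V k                             ∎

  -- Both W² and A V² may reach degree d, so the scalar is unknown. It enters the values at a and at
  -- b alike, and their product contains its square.
  quadratic-even : ∀ k → d ≡ suc k ℕ.+ suc k → ∀ a b → ¬ (b - a ≡ 0#) → SquareModulo ([ a -X] *P [ b -X]) →
    IsSquare (eval h a · eval h b)
  quadratic-even k eq a b b≢a square = RingLemmas.square-quotient fieldRing (proj₂ (inverse _ scalar≢0))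
      (≡.trans (RingLemmas.interchange-scalar fieldRing (eval h a) (eval h b) _)
        (≡.trans (≡.cong₂ _·_ (value-square a (root-product a [ b -X]) E) (value-square b root-b E))
          (≡.sym (RingLemmas.interchange-squares fieldRing (eval W a) (eval W b)))))
    where
    A = [ a -X] *P [ b -X]
    d≡ : d ≡ suc (suc (k ℕ.+ k))
    d≡ = ≡.trans eq (≡.cong suc (ℕ.+-suc k k))
    root-b : eval A b ≡ 0#
    root-b = ≡.trans (eval-cong b (*P-comm [ a -X] [ b -X])) (root-product b [ a -X])
    E = norm-equation k (suc (suc k)) (≡.trans eq (≡.sym (ℕ.+-suc k (suc k)))) a [ b -X]
      (λ z → b≢a (≡.trans (≡.sym (eval-[-X] b a)) z)) square
      (λ V W Vb Wb → Bounded-- (≡.subst (λ m → Bounded (suc m) (W *P W)) (≡.sym eq) (Bounded-* W W Wb Wb))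
        (≡.subst (λ m → Bounded (suc m) (A *P (V *P V))) (≡.sym d≡) (Bounded-* A (V *P V)
          (Bounded-* [ a -X] [ b -X] (bound ([-X]-HasDegree a)) (bound ([-X]-HasDegree b))) (Bounded-* V V Vb Vb))))
    open NormEquation E

-- The sign of t, and the passage of squares from K to L.

module SignChoice {c ℓ} (K : CommutativeRing c ℓ) where
  open CommutativeRing K renaming (_*_ to _·_)
  open RingLemmas K
  open IntegerSolver K

  2# : Carrier
  2# = 1# + 1#

  -- The product of 2(t - e) and 2(- t - e) is 4ν, so one of them is a square.
  choose-sign : ZeroOrUnit → ∀ ν → (∀ u → Square u ⊎ Square (ν · u)) →
    ∀ t e → ν ≈ e · e - t · t → ∃ λ t′ → t′ · t′ ≈ t · t × Square (2# · (t′ - e))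
  choose-sign zero-or-unit ν index-two t e ν≈ with index-two (2# · (t - e)) | zero-or-unit (2# · (t - e))
  ... | inj₁ square    | _               = t , refl , square
  ... | inj₂ _         | inj₁ z          = t , refl , (0# , trans (zeroˡ 0#) (sym z))
  -- With A = 2(t - e) and ν A = x², the other candidate satisfies 2(- t - e) A² = 4 ν A = (2x)²,
  -- and A is a unit here.
  ... | inj₂ (x , xx≈) | inj₂ (A⁻¹ , inv) = - t , solve 1 (λ t → (:- t) :* (:- t) := t :* t) refl t , square-quotient {z = 2# · x} inv (trans
        (solve 2 (λ t e → let two = :1 :+ :1 in two :* (:- t :- e) :* ((two :* (t :- e)) :* (two :* (t :- e)))
          := (two :* two) :* ((e :* e :- t :* t) :* (two :* (t :- e)))) refl t e)
        (trans (*-congˡ (trans (*-congʳ (sym ν≈)) (sym xx≈))) (sym (interchange-squares 2# x))))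

module QuadraticExtension {c ℓ c′ ℓ′} (K : CommutativeRing c ℓ) (L : CommutativeRing c′ ℓ′) where
  private
    module K = CommutativeRing K
    module L = CommutativeRing L
  open RingLemmas using (Square; ZeroOrUnit)
  open L using (trans; sym; refl; +-cong; *-cong; -‿cong; +-congˡ; *-congʳ; *-congˡ)

  K2 : K.Carrier
  K2 = K.1# K.+ K.1#

  module Along
    (ψ : K.Carrier → L.Carrier) (ψ-cong : ∀ {x y} → x K.≈ y → ψ x L.≈ ψ y)
    (ψ-+ : ∀ x y → ψ (x K.+ y) L.≈ ψ x L.+ ψ y) (ψ-* : ∀ x y → ψ (x K.* y) L.≈ ψ x L.* ψ y)
    (ψ-neg : ∀ x → ψ (K.- x) L.≈ L.- ψ x) (ψ-1 : ψ K.1# L.≈ L.1#)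
    (K-zero-or-unit : ZeroOrUnit K) (L-zero-or-unit : ZeroOrUnit L)
    (ν : K.Carrier) (ν-nonsquare : ¬ Square K ν) (index-two : ∀ u → Square K u ⊎ Square K (ν K.* u))
    (β : L.Carrier) (ψν≈ : ψ ν L.≈ β L.* β) where

    ψ-square : ∀ {u} → Square K u → Square L (ψ u)
    ψ-square (x , xx≈) = ψ x , trans (sym (ψ-* x x)) (ψ-cong xx≈)

    -- ν is nonzero because zero is a square. Division by β then turns a square root of ν u into one
    -- of u.
    β-unit : ∃ λ γ → β L.* γ L.≈ L.1#
    β-unit with K-zero-or-unit ν
    ... | inj₁ ν≈0 = contradiction (K.0# , K.trans (K.zeroˡ K.0#) (K.sym ν≈0)) ν-nonsquare
    ... | inj₂ (ν⁻¹ , inv) = β L.* ψ ν⁻¹ , trans (sym (L.*-assoc β β (ψ ν⁻¹))) (trans (*-congʳ (sym ψν≈))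
          (trans (sym (ψ-* ν ν⁻¹)) (trans (ψ-cong inv) ψ-1)))

    -- ν acquires a square root, and every element of K is a square up to ν.
    image-square : ∀ u → Square L (ψ u)
    image-square u with index-two u
    ... | inj₁ square    = ψ-square square
    ... | inj₂ νu-square with ψ-square νu-square
    ...   | x , xx≈ = RingLemmas.square-quotient L (proj₂ β-unit) (trans (L.*-comm _ _) (trans (*-congʳ (sym ψν≈)) (trans (sym (ψ-* ν u)) (sym xx≈))))

    open QuadraticTower L L-zero-or-unit using (2#; square-in-tower)

    ψ-- : ∀ x y → ψ (x K.- y) L.≈ ψ x L.- ψ y
    ψ-- x y = trans (ψ-+ x (K.- y)) (+-congˡ (ψ-neg y))

    ψ-2* : ∀ x → ψ (K2 K.* x) L.≈ 2# L.* ψ x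
    ψ-2* x = trans (ψ-* K2 x) (*-congʳ (trans (ψ-+ K.1# K.1#) (+-cong ψ-1 ψ-1)))

    ψ-0 : ψ K.0# L.≈ L.0#
    ψ-0 = trans (ψ-cong (K.sym (K.-‿inverseʳ K.0#))) (trans (ψ-- K.0# K.0#) (L.-‿inverseʳ (ψ K.0#)))

    -- The shifted traces and negated norm roots for s and - s are images of elements of K, and each
    -- such image is a square by `image-square`.
    square-in-extension : ∀ b e t s ρ δ →
      b K.* b K.+ K2 K.* e K.≈ K.0# → K2 K.* (ρ K.* ρ) K.- K.1# K.≈ K.0# → s K.* s K.- K2 K.* (t K.- e) K.≈ K.0# →
      ν K.≈ e K.* e K.- t K.* t → β L.≈ δ L.* δ L.+ ψ e → Square L (ψ b L.- δ)
    square-in-extension b e t s ρ δ b²≈ ρ²≈ s²≈ ν≈ β≈ = square-in-tower (ψ b) (ψ e) (ψ t) (ψ ρ)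
      (trans (+-cong (sym (ψ-* b b)) (sym (ψ-2* e))) (image-zero (ψ-+ _ _) b²≈))
      (trans (+-cong (trans (*-congˡ (sym (ψ-* ρ ρ))) (sym (ψ-2* (ρ K.* ρ)))) (-‿cong (sym ψ-1))) (image-zero (ψ-- _ _) ρ²≈))
      δ (ψ s)
      (trans (+-cong (sym (ψ-* s s)) (-‿cong (trans (*-congˡ (sym (ψ-- t e))) (sym (ψ-2* (t K.- e)))))) (image-zero (ψ-- _ _) s²≈))
      (trans (+-cong (sym (*-cong β≈ β≈)) (-‿cong (trans (+-cong (sym (ψ-* e e)) (-‿cong (sym (ψ-* t t)))) (trans (sym (ψ-- _ _)) (ψ-cong (K.sym ν≈))))))
        (trans (+-cong (sym ψν≈) refl) (L.-‿inverseʳ (ψ ν))))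
      (trace-square s refl) (norm-square s refl) (trace-square (K.- s) (ψ-neg s)) (norm-square (K.- s) (ψ-neg s))
      where
      image-zero : ∀ {x y} → ψ x L.≈ y → x K.≈ K.0# → y L.≈ L.0#
      image-zero p q = trans (sym p) (trans (ψ-cong q) ψ-0)
      -- The image r′ is kept separate from ψ r, since ψ (- s) agrees with - ψ s only up to the
      -- equality of L.
      rootNorm-image : ∀ r {r′} → ψ r L.≈ r′ → ψ ((b K.- r) K.* ρ) L.≈ (ψ b L.- r′) L.* ψ ρ
      rootNorm-image r p = trans (ψ-* _ ρ) (*-congʳ (trans (ψ-- b r) (+-congˡ (-‿cong p))))
      trace-square : ∀ r {r′} → ψ r L.≈ r′ → Square L (2# L.* ψ b L.- r′ L.+ 2# L.* ((ψ b L.- r′) L.* ψ ρ))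
      trace-square r p = RingLemmas.square-resp L
        (trans (ψ-+ _ _) (+-cong (trans (ψ-- _ r) (+-cong (ψ-2* b) (-‿cong p))) (trans (ψ-2* _) (*-congˡ (rootNorm-image r p)))))
        (image-square (K2 K.* b K.- r K.+ K2 K.* ((b K.- r) K.* ρ)))
      norm-square : ∀ r {r′} → ψ r L.≈ r′ → Square L (L.- ((ψ b L.- r′) L.* ψ ρ))
      norm-square r p = RingLemmas.square-resp L (trans (ψ-neg _) (-‿cong (rootNorm-image r p))) (image-square (K.- ((b K.- r) K.* ρ)))

-- Completing the square at the critical point.

module CriticalPoints {c} (F : FiniteField c) where
  open FiniteField F hiding (_*_) renaming (Carrier to 𝔽)
  open FiniteField F using () renaming (_*_ to _·_)
  open FieldDefs F
  open PolynomialRing F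
  open PolynomialDegree F
  open FieldEvaluation F
  open CommutativeRing fieldRing using (+-identityʳ; zeroˡ; zeroʳ; *-identityˡ; *-identityʳ; *-comm)

  mutual
    derivative-tail : ∀ (a : 𝔽) (p : Poly) (k : 𝔽) (r : Poly) → Poly
    derivative-tail a p k r = _

    derivative-unfold : ∀ a₀ a₁ a₂ r → deriv (a₀ ∷ a₁ ∷ a₂ ∷ r)
      ≡ 1# · a₁ ∷ (1# + 1#) · a₂ ∷ derivative-tail a₀ (a₁ ∷ a₂ ∷ r) (1# + 1# + 1#) r
    -- Abstracting the arguments makes unification solve `derivative-tail` with the local function of `deriv`.
    derivative-unfold a₀ a₁ a₂ r with a₁ ∷ a₂ ∷ r | 1# + 1# + 1#
    ... | p | k = ≡.refl

  -- The list of a quadratic polynomial may continue with zeros after its third entry; these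
  -- contribute nothing to the derivative.
  derivative-tail-null : ∀ a p k r x → r ≋ [] → eval (derivative-tail a p k r) x ≡ 0#
  derivative-tail-null a p k []      x e = ≡.refl
  derivative-tail-null a p k (b ∷ r) x e = ≡.trans
    (≡.cong₂ (λ y z → y + x · z) (≡.trans (≡.cong (k ·_) (at e 0)) (zeroʳ k)) (derivative-tail-null a p (k + 1#) r x (tail-≋ {b} {0#} (≋-trans e (≋-sym 0∷[]≋[])))))
    (≡.trans (≡.cong (0# +_) (zeroʳ x)) (+-identityʳ 0#))

  const-* : ∀ a b → const (a · b) ≋ const a *P const b
  const-* a b = ∷-cong (≡.sym (+-identityʳ _)) ≋-refl

  const-0 : const 0# ≋ []
  const-0 = 0∷[]≋[]

  critical-coefficient : ∀ a₀ a₁ a₂ r γ → a₂ ≡ 1# → r ≋ [] → eval (deriv (a₀ ∷ a₁ ∷ a₂ ∷ r)) γ ≡ 0# → a₁ + (1# + 1#) · γ ≡ 0#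
  critical-coefficient a₀ a₁ a₂ r γ monic r≋0 critical = begin
    a₁ + (1# + 1#) · γ                           ≡⟨ ≡.cong₂ _+_ (*-identityˡ a₁) (≡.trans (*-comm γ _) (≡.cong (_· γ) (≡.trans (+-identityʳ _) (*-identityʳ _)))) ⟨
    1# · a₁ + γ · ((1# + 1#) · 1# + 0#)          ≡⟨ ≡.cong₂ (λ y z → 1# · a₁ + γ · ((1# + 1#) · y + z)) monic
      (≡.trans (≡.cong (γ ·_) (derivative-tail-null a₀ (a₁ ∷ a₂ ∷ r) (1# + 1# + 1#) r γ r≋0)) (zeroʳ γ)) ⟨
    1# · a₁ + γ · ((1# + 1#) · a₂ + γ · eval (derivative-tail a₀ (a₁ ∷ a₂ ∷ r) (1# + 1# + 1#) r) γ) ≡⟨ ≡.cong (λ q → eval q γ) (derivative-unfold a₀ a₁ a₂ r) ⟨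
    eval (deriv (a₀ ∷ a₁ ∷ a₂ ∷ r)) γ             ≡⟨ critical ⟩
    0#                                           ∎
    where open ≡.≡-Reasoning

  square-form : 𝔽 → 𝔽 → Poly
  square-form γ d = (X -P const γ) *P (X -P const γ) +P const d

  square-form-cong : ∀ γ {d e} → d ≡ e → square-form γ d ≋ square-form γ e
  square-form-cong γ ≡.refl = ≋-refl

  -- Expanding around γ leaves the linear term (X - γ)(a₁ + 2γ), which vanishes by criticality; with
  -- γ given, there is no division by 2.
  complete-square : ∀ a₀ a₁ a₂ r γ → a₂ ≡ 1# → r ≋ [] → a₁ + (1# + 1#) · γ ≡ 0# →
    a₀ ∷ a₁ ∷ a₂ ∷ r ≋ square-form γ (a₀ + γ · (a₁ + γ · 1#))
  complete-square a₀ a₁ a₂ r γ monic r≋0 critical = begin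
    a₀ ∷ a₁ ∷ a₂ ∷ r
      ≈⟨ ∷-cong ≡.refl (∷-cong ≡.refl (∷-cong monic r≋0)) ⟩
    a₀ ∷ a₁ ∷ const 1#
      ≈⟨ ∷≋ a₀ (a₁ ∷ const 1#) ⟩
    const a₀ +P X *P (a₁ ∷ const 1#)
      ≈⟨ +-congˡ {const a₀} (*P-congˡ X (∷≋ a₁ (const 1#))) ⟩
    const a₀ +P X *P (const a₁ +P X *P const 1#)
      ≈⟨ RingLemmas.completed-square polynomialRing (const a₀) (const a₁) X (const γ) ⟩
    ((X -P const γ) *P (X -P const γ) +P (const a₀ +P const γ *P (const a₁ +P const γ *P const 1#)))
      +P (X -P const γ) *P (const a₁ +P (const 1# +P const 1#) *P const γ)
      ≈⟨ RingLemmas.+zeros polynomialRing {a = (X -P const γ) *P (X -P const γ) +P (const a₀ +P const γ *P (const a₁ +P const γ *P const 1#))}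
           {x = X -P const γ} {e = const a₁ +P (const 1# +P const 1#) *P const γ} linear≋0 ⟩
    (X -P const γ) *P (X -P const γ) +P (const a₀ +P const γ *P (const a₁ +P const γ *P const 1#))
      ≈⟨ +-congˡ {(X -P const γ) *P (X -P const γ)} constant ⟩
    square-form γ (a₀ + γ · (a₁ + γ · 1#)) ∎
    where
    open CommutativeRing polynomialRing using (+-congˡ; setoid)
    open SetoidReasoning setoid
    linear≋0 : const a₁ +P (const 1# +P const 1#) *P const γ ≋ []
    linear≋0 = ≋-trans (+-congˡ {const a₁} {(const 1# +P const 1#) *P const γ} {const ((1# + 1#) · γ)} (≋-sym (const-* (1# + 1#) γ)))
      (≋-trans (∷-cong critical ≋-refl) const-0)
    constant : const a₀ +P const γ *P (const a₁ +P const γ *P const 1#) ≋ const (a₀ + γ · (a₁ + γ · 1#))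
    constant = +-congˡ {const a₀} {const γ *P (const a₁ +P const γ *P const 1#)} {const (γ · (a₁ + γ · 1#))}
      (≋-trans (*P-congˡ (const γ) {const a₁ +P const γ *P const 1#} {const (a₁ + γ · 1#)}
          (+-congˡ {const a₁} {const γ *P const 1#} {const (γ · 1#)} (≋-sym (const-* γ 1#))))
        (≋-sym (const-* γ (a₁ + γ · 1#))))

  eval-square-form : ∀ γ d x → eval (square-form γ d) x ≡ (x + - γ) · (x + - γ) + d
  eval-square-form γ d x = ≡.trans (eval-+ x ((X -P const γ) *P (X -P const γ)) (const d)) (≡.cong₂ _+_
    (≡.trans (eval-* x (X -P const γ) (X -P const γ)) (≡.cong₂ _·_ X-γ X-γ)) (eval-const x d))
    where
    X-γ : eval (X -P const γ) x ≡ x + - γ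
    X-γ = ≡.trans (eval-- x X (const γ)) (≡.cong₂ (λ y z → y + - z) (eval-X x) (eval-const x γ))

  critical-form : ∀ f γ → MonicQuadratic f → CriticalPoint f γ →
    f ≋ square-form γ (eval f γ)
  critical-form f γ (monic , degree≡2) critical = go f (≡.subst (λ n → coeff f n ≡ 1#) degree≡2 monic)
      (≡.subst (λ n → Bounded (suc n) f) degree≡2 (Bounded-degree f)) critical
    where
    value : ∀ {p d} → p ≋ square-form γ d → p ≋ square-form γ (eval p γ)
    value {p} {d} e = ≋-trans e (square-form-cong γ (≡.sym value≡d))
      where
      value≡d : eval p γ ≡ d
      value≡d = ≡.trans (eval-cong γ e) (≡.trans (eval-square-form γ d γ) (≡.trans
        (≡.cong (_+ d) (≡.trans (≡.cong (_· (γ + - γ)) (CommutativeRing.-‿inverseʳ fieldRing γ)) (zeroˡ _)))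
        (CommutativeRing.+-identityˡ fieldRing d)))
    go : ∀ p → coeff p 2 ≡ 1# → Bounded 3 p → CriticalPoint p γ → p ≋ square-form γ (eval p γ)
    go (a₀ ∷ a₁ ∷ a₂ ∷ r) lead b crit = value (complete-square a₀ a₁ a₂ r γ lead r≋0 (critical-coefficient a₀ a₁ a₂ r γ lead r≋0 crit))
      where
      r≋0 : r ≋ []
      r≋0 = coeffwise λ i → beyond b (suc (suc (suc i))) (s≤s (s≤s (s≤s z≤n)))
    go []            lead b crit = contradiction lead 0≢1
    go (_ ∷ [])      lead b crit = contradiction lead 0≢1
    go (_ ∷ _ ∷ [])  lead b crit = contradiction lead 0≢1

-- Which elements of the residue field of g are squares.

module ResidueSquares {c} (F : FiniteField c) (odd : FieldDefs.OddCharacteristic F) {d} (g : FieldDefs.Poly F)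
  (deg : PolynomialDegree.HasDegree F d g) (monic : FieldDefs.coeff F g d ≡ FiniteField.1# F)
  (irreducible : FieldDefs.Irreducible F g) (k : ℕ) (d-even : d ≡ suc k ℕ.+ suc k)
  (a : FiniteField.Carrier F) (value-nonsquare : ¬ FieldDefs.IsSquare F (FieldDefs.eval F g a)) where
  open FieldDefs F
  open FiniteField F hiding (_*_; Carrier)
  open FiniteField F using () renaming (_*_ to _·_)
  open PolynomialRing F
  open PolynomialDegree F
  open FieldEvaluation F
  open CriticalPoints F using (const-*)
  open ResidueField g deg irreducible public
  open Reciprocity F g deg monic using (linear-even; quadratic-even)
  open CommutativeRing fieldRing using (_-_; +-identityʳ; *-identityʳ; zeroˡ; zeroʳ)
  open RingProperties (CommutativeRing.ring fieldRing) using (-0#≈0#; -1*x≈-x; -‿involutive)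
  open RingLemmas quotientRing using (Square; square-resp; square-*)

  abstract
    ν : Poly
    ν = X -P const a

    ν≋X-a : ν ≋ X -P const a
    ν≋X-a = ≋-refl

  ν≋ : ν ≋ [ a -X] *P const (- 1#)
  ν≋ = ≋-trans ν≋X-a (≋-trans (RingLemmas.negated-difference polynomialRing (const a) X)
    (*P-cong (≋-sym ([-X]≋ a)) (∷-cong (*-identityʳ (- 1#)) ≋-refl)))

  -‿≢0 : ∀ {b} → ¬ (b ≡ 0#) → ¬ ((- 1#) · b ≡ 0#)
  -‿≢0 b≢0 e = b≢0 (≡.trans (≡.sym (-‿involutive _)) (≡.trans (≡.cong -_ (≡.trans (≡.sym (-1*x≈-x _)) e)) -0#≈0#))

  ν*const≋ : ∀ b → ν *P const b ≋ [ a -X] *P const ((- 1#) · b)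
  ν*const≋ b = ≋-trans (*P-congʳ (const b) ν≋) (≋-trans (*P-assoc [ a -X] (const (- 1#)) (const b))
    (*P-congˡ [ a -X] (≋-sym (const-* (- 1#) b))))

  -- ν b is the scalar - b times a - X, so a square root of it would make g(a) a square. With b = 1
  -- this concerns ν; for general b it yields `const-square`.
  ν*const-nonsquare : ∀ b → ¬ (b ≡ 0#) → ¬ Square (ν *P const b)
  ν*const-nonsquare b b≢0 square = value-nonsquare (linear-even k d-even a ((- 1#) · b) (-‿≢0 b≢0) (square-resp (≈⇒∼ (ν*const≋ b)) square))

  ν-nonsquare : ¬ Square ν
  ν-nonsquare square = ν*const-nonsquare 1# (0≢1 ∘ ≡.sym)
    (square-resp (≈⇒∼ (≋-sym (≋-trans (*P-comm ν (const 1#)) (*P-identityˡ ν)))) square)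

  abstract
    index-two : ∀ u → Square u ⊎ Square (ν *P u)
    index-two = IndexTwo.index-two quotientRing _∼?_ zero-or-unit (residues d) quotient-complete ν ν-nonsquare

  -- By index two, the alternative is that ν b is a square.
  const-square : ∀ b → ¬ (b ≡ 0#) → Square (const b)
  const-square b b≢0 = fromInj₁ (λ square → contradiction square (ν*const-nonsquare b b≢0)) (index-two (const b))

  two : Poly
  two = const 1# +P const 1#

  half-root : ∀ {h ρ} → (1# + 1#) · h ≡ 1# → ρ *P ρ ∼ const h → two *P (ρ *P ρ) -P const 1# ∼ []
  half-root {h} {ρ} inv ρρ∼h = RingLemmas.≈⇒diff≈0 quotientRing {two *P (ρ *P ρ)} {const 1#}
    (∼-trans {two *P (ρ *P ρ)} {two *P const h} (∼-*-cong {two} (≈⇒∼ ≋-refl) ρρ∼h)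
      (≈⇒∼ (≋-trans (≋-sym (const-* (1# + 1#) h)) (∷-cong inv ≋-refl))))

  half-square : ∃ λ ρ → two *P (ρ *P ρ) -P const 1# ∼ []
  half-square = proj₁ square , half-root {ρ = proj₁ square} (proj₂ half) (proj₂ square)
    where
    half : ∃ λ h → (1# + 1#) · h ≡ 1#
    half = inverse (1# + 1#) odd
    square : Square (const (proj₁ half))
    square = const-square (proj₁ half)
      (λ z → 0≢1 (≡.trans (≡.sym (zeroʳ (1# + 1#))) (≡.trans (≡.cong ((1# + 1#) ·_) (≡.sym z)) (proj₂ half))))

  root⇒non-unit : ∀ b → eval g b ≡ 0# → ¬ (∃ λ q → [ b -X] *P q ∼ const 1#)
  root⇒non-unit b root (q , modulo m e) = 0≢1 (begin
      0#                                     ≡⟨ zeroˡ (eval q b) ⟨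
      0# · eval q b                          ≡⟨ ≡.cong (_· eval q b) (eval-root b) ⟨
      eval [ b -X] b · eval q b              ≡⟨ eval-* b [ b -X] q ⟨
      eval ([ b -X] *P q) b                  ≡⟨ eval-cong b e ⟩
      eval (const 1# +P m *P g) b            ≡⟨ eval-+ b (const 1#) (m *P g) ⟩
      eval (const 1#) b + eval (m *P g) b    ≡⟨ ≡.cong₂ _+_ (eval-const b 1#) (≡.trans (eval-* b m g) (≡.trans (≡.cong (eval m b ·_) root) (zeroʳ _))) ⟩
      1# + 0#                                ≡⟨ +-identityʳ 1# ⟩
      1#                                     ∎)
    where open ≡.≡-Reasoning

  -- The degenerate case g(b) = 0 is not refuted: b - X is then no unit, hence zero in the residue
  -- field, and zero is a square.
  root⇒square : ∀ b → eval g b ≡ 0# → Square [ b -X]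
  root⇒square b root = [] , ∼-sym (fromInj₁ (λ unit → contradiction unit (root⇒non-unit b root)) (zero-or-unit [ b -X]))

  -1-square : Square (const (- 1#))
  -1-square = const-square (- 1#) λ e → -‿≢0 (0≢1 ∘ ≡.sym) (≡.trans (*-identityʳ (- 1#)) e)

  ν*[-X]*-1≋ : ∀ b → (ν *P [ b -X]) *P const (- 1#) ≋ [ a -X] *P [ b -X]
  ν*[-X]*-1≋ b = begin
    (ν *P [ b -X]) *P m                ≈⟨ *P-congʳ m (*P-congʳ [ b -X] ν≋) ⟩
    (([ a -X] *P m) *P [ b -X]) *P m   ≈⟨ RingLemmas.gather-factor polynomialRing [ a -X] m [ b -X] ⟩
    (m *P m) *P ([ a -X] *P [ b -X])   ≈⟨ *P-congʳ ([ a -X] *P [ b -X]) (≋-trans (≋-sym (const-* (- 1#) (- 1#)))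
                                            (∷-cong (≡.trans (-1*x≈-x (- 1#)) (-‿involutive 1#)) ≋-refl)) ⟩
    const 1# *P ([ a -X] *P [ b -X])   ≈⟨ *P-identityˡ ([ a -X] *P [ b -X]) ⟩
    [ a -X] *P [ b -X]                 ∎
    where
    m = const (- 1#)
    open SetoidReasoning (CommutativeRing.setoid polynomialRing)

  -- ν (b - X) differs from (a - X)(b - X) by the factor - 1, itself a square among the scalars.
  product-square : ∀ b → ¬ (b - a ≡ 0#) → Square (ν *P [ b -X]) → IsSquare (eval g a · eval g b)
  product-square b b≢a square = quadratic-even k d-even a b b≢a
    (square-resp (≈⇒∼ (ν*[-X]*-1≋ b)) (square-* square -1-square))

  value-not-square : ∀ b y → ¬ (b - a ≡ 0#) → y · y ≡ eval g b → ¬ (y ≡ 0#) → ¬ Square (ν *P [ b -X])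
  value-not-square b y b≢a yy≡ y≢0 square = value-nonsquare (RingLemmas.square-quotient fieldRing (proj₂ (inverse y y≢0))
    (≡.trans (≡.cong (eval g a ·_) yy≡) (≡.sym (proj₂ (product-square b b≢a square)))))

  -- The converse of `linear-even`. If b - X were not a square, ν (b - X) would be one, so g(a) g(b)
  -- would be a square; the nonzero square g(b) cancels and contradicts the choice of a.
  linear-square : ∀ b → ¬ (b - a ≡ 0#) → IsSquare (eval g b) → Square [ b -X]
  linear-square b b≢a (y , yy≡) with y ≟ 0#
  ... | yes y≡0 = root⇒square b (≡.trans (≡.sym yy≡) (≡.trans (≡.cong (_· y) y≡0) (zeroˡ y)))
  ... | no  y≢0 = fromInj₁ (λ square → contradiction square (value-not-square b y b≢a yy≡ y≢0)) (index-two [ b -X])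

-- The orbit relation and the substitution of f(f(x)).

module Composition {c} (F : FiniteField c) (f : FieldDefs.Poly F) (γ : FiniteField.Carrier F)
  (f-form : PolynomialRing._≋_ F f (CriticalPoints.square-form F γ (FieldDefs.eval F f γ))) where
  open FieldDefs F
  open FiniteField F hiding (_*_; Carrier)
  open FiniteField F using () renaming (_*_ to _·_)
  open PolynomialRing F
  open PolynomialDegree F
  open CriticalPoints F
  open FieldEvaluation F
  open CommutativeRing fieldRing using (_-_)

  b₁ e : FiniteField.Carrier F
  b₁ = eval f γ
  e  = b₁ - γ

  eval-f : ∀ x → eval f x ≡ (x - γ) · (x - γ) + b₁
  eval-f x = ≡.trans (eval-cong x f-form) (eval-square-form γ b₁ x)

  -- f(x) = f(y) forces x - γ = ±(y - γ).
  preperiodic : ∀ x → eval f b₁ ≡ eval f (eval f x) → ¬ (b₁ ≡ eval f x) → (x - γ) · (x - γ) + (1# + 1#) · e ≡ 0#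
  -- Since (x - γ)² + e = f(x) - γ, the claim is e = - (f(x) - γ); the positive sign would give b₁ =
  -- f(x).
  preperiodic x eq b₁≢fx = ≡.trans (double-as-difference ((x - γ) · (x - γ)) b₁ γ)
    (≈⇒diff≈0 (≡.trans (fromInj₂ (λ same → contradiction (+-cancelʳ (- γ) b₁ (eval f x) same) b₁≢fx)
      (square-roots field-domain (+-cancelʳ b₁ _ _ (≡.trans (≡.sym (eval-f b₁)) (≡.trans eq (eval-f (eval f x)))))))
      (≡.cong (λ y → - (y - γ)) (eval-f x))))
    where
    open RingLemmas fieldRing using (square-roots; double-as-difference; ≈⇒diff≈0)
    open RingProperties (CommutativeRing.ring fieldRing) using (+-cancelʳ)

  module _ (q : Poly) where
    open Evaluation.At F polynomialRing const (λ _ _ → ≋-refl) const-* const-0 ≋-refl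
      (λ p → compose p q) q ≋-refl (λ _ _ → ≋-refl) public
      using () renaming (evalA-cong to compose-cong; evalA-+ to compose-+; evalA-* to compose-*; evalA-const to compose-const;
        evalA-X to compose-X; evalA-neg to compose-neg)

  compose-- : ∀ q a b → compose (a -P b) q ≋ compose a q -P compose b q
  compose-- q a b = ≋-trans (compose-+ q a (negP b)) (+P-cong {compose a q} ≋-refl (compose-neg q b))

  compose-f : ∀ q → compose f q ≋ (q -P const γ) *P (q -P const γ) +P const b₁
  compose-f q = ≋-trans (compose-cong q f-form) (≋-trans (compose-+ q ((X -P const γ) *P (X -P const γ)) (const b₁))
    (+P-cong (≋-trans (compose-* q (X -P const γ) (X -P const γ)) (*P-cong X-γ X-γ)) (compose-const q b₁)))
    where
    X-γ : compose (X -P const γ) q ≋ q -P const γ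
    X-γ = ≋-trans (compose-- q X (const γ)) (+P-cong (compose-X q) (scale-cong ≡.refl (compose-const q γ)))

  const-- : ∀ a b → const (a - b) ≋ const a -P const b
  const-- a b = ∷-cong (≡.cong (a +_) (≡.sym (coeff-neg (const b) 0))) ≋-refl

  abstract
    ψ : Poly → Poly
    ψ p = compose p (compose f f)

    ψ≋ : ∀ p → ψ p ≋ compose p (compose f f)
    ψ≋ p = ≋-refl

    ψ-cong : ∀ {p q} → p ≋ q → ψ p ≋ ψ q
    ψ-cong = compose-cong (compose f f)

    ψ-+ : ∀ p q → ψ (p +P q) ≋ ψ p +P ψ q
    ψ-+ = compose-+ (compose f f)

    ψ-* : ∀ p q → ψ (p *P q) ≋ ψ p *P ψ q
    ψ-* = compose-* (compose f f)

    ψ-neg : ∀ p → ψ (negP p) ≋ negP (ψ p)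
    ψ-neg = compose-neg (compose f f)

    ψ-const : ∀ a → ψ (const a) ≋ const a
    ψ-const = compose-const (compose f f)

    ψ-X : ψ X ≋ compose f f
    ψ-X = compose-X (compose f f)

  -- The constant of β is written `ψ (const e)`, to which `const e` is equal, to match the form δ² +
  -- ψ e that `square-in-extension` expects.
  δ β : Poly
  δ = X -P const γ
  β = δ *P δ +P ψ (const e)

  f-γ : f -P const γ ≋ β
  f-γ = begin
    f -P const γ                           ≈⟨ +P-cong f-form (≋-refl {negP (const γ)}) ⟩
    (δ *P δ +P const b₁) -P const γ        ≈⟨ RingLemmas.difference-in-sum polynomialRing (δ *P δ) (const b₁) (const γ) ⟩
    δ *P δ +P (const b₁ -P const γ)        ≈⟨ +P-cong (≋-refl {δ *P δ}) (≋-trans (≋-sym (const-- b₁ γ)) (≋-sym (ψ-const e))) ⟩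
    δ *P δ +P ψ (const e)                  ∎
    where open SetoidReasoning (CommutativeRing.setoid polynomialRing)

  ψ-X-b₁ : ψ (X -P const b₁) ≋ β *P β
  ψ-X-b₁ = begin
    ψ (X -P const b₁)                                             ≈⟨ ψ-+ X (negP (const b₁)) ⟩
    ψ X +P ψ (negP (const b₁))                                    ≈⟨ +P-cong (≋-trans ψ-X (compose-f f)) (≋-trans (ψ-neg (const b₁)) (scale-cong ≡.refl (ψ-const b₁))) ⟩
    ((f -P const γ) *P (f -P const γ) +P const b₁) -P const b₁    ≈⟨ RingLemmas.drop-constant polynomialRing ((f -P const γ) *P (f -P const γ)) (const b₁) ⟩
    (f -P const γ) *P (f -P const γ)                              ≈⟨ *P-cong f-γ f-γ ⟩
    β *P β                                                        ∎
    where open SetoidReasoning (CommutativeRing.setoid polynomialRing)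

-- The value of a factor H of g(f(f(x))).

module FactorValue {c} (F : FiniteField c) (odd : FieldDefs.OddCharacteristic F)
  (f : FieldDefs.Poly F) (γ : FiniteField.Carrier F)
  (f-form : PolynomialRing._≋_ F f (CriticalPoints.square-form F γ (FieldDefs.eval F f γ)))
  (g : FieldDefs.Poly F) (g-monic : FieldDefs.Monic F g) (g-irreducible : FieldDefs.Irreducible F g)
  (k : ℕ) (g-even : FieldDefs.degree F g ≡ suc k ℕ.+ suc k)
  (g-nonsquare : ¬ FieldDefs.IsSquare F (FieldDefs.eval F g (FieldDefs.eval F f γ)))
  (H : FieldDefs.Poly F) (H-monic : FieldDefs.Monic F H) (H-irreducible : FieldDefs.Irreducible F H)
  (H∣ : FieldDefs._∣P_ F H (FieldDefs.compose F g (FieldDefs.compose F f f))) where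
  open FieldDefs F
  open FiniteField F hiding (_*_; Carrier)
  open FiniteField F using () renaming (_*_ to _·_)
  open PolynomialRing F
  open PolynomialDegree F
  open CriticalPoints F
  open FieldEvaluation F
  open Composition F f γ f-form
  open CommutativeRing fieldRing using (_-_)
  open ResidueSquares F odd g (Monic⇒HasDegree g g-monic) g-monic g-irreducible k g-even b₁ g-nonsquare
    using (ν; ν≋X-a; ν-nonsquare; index-two; half-square; linear-square; two)

  module K = ResidueField g (Monic⇒HasDegree g g-monic) g-irreducible
  module L = ResidueField H (Monic⇒HasDegree H H-monic) H-irreducible
  open RingLemmas using (Square)

  -- `ψ` sends g to g(f(f(x))), a multiple of H, so it descends to residue classes.
  ψ-∼ : ∀ {p q} → p K.∼ q → ψ p L.∼ ψ q
  ψ-∼ {p} {q} (K.modulo m e) = L.modulo (ψ m *P proj₁ H∣) (begin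
    ψ p                               ≈⟨ ψ-cong e ⟩
    ψ (q +P m *P g)                   ≈⟨ ψ-+ q (m *P g) ⟩
    ψ q +P ψ (m *P g)                 ≈⟨ +P-cong (≋-refl {ψ q}) (≋-trans (ψ-* m g) (*P-congˡ (ψ m) ψg≋)) ⟩
    ψ q +P ψ m *P (proj₁ H∣ *P H)     ≈⟨ +P-cong (≋-refl {ψ q}) (≋-sym (*P-assoc (ψ m) (proj₁ H∣) H)) ⟩
    ψ q +P (ψ m *P proj₁ H∣) *P H     ∎)
    where
    open SetoidReasoning (CommutativeRing.setoid polynomialRing)
    ψg≋ : ψ g ≋ proj₁ H∣ *P H
    ψg≋ = ≋-trans (ψ≋ g) (≋-trans (≋-sym (coeffwise (proj₂ H∣))) (*P-comm H (proj₁ H∣)))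

  open QuadraticExtension.Along K.quotientRing L.quotientRing ψ ψ-∼
    (λ p q → L.≈⇒∼ (ψ-+ p q)) (λ p q → L.≈⇒∼ (ψ-* p q)) (λ p → L.≈⇒∼ (ψ-neg p)) (L.≈⇒∼ (ψ-const 1#))
    K.zero-or-unit L.zero-or-unit ν ν-nonsquare index-two β
    (L.≈⇒∼ (≋-trans (ψ-cong ν≋X-a) ψ-X-b₁))
    using (square-in-extension)

  -- From b₂ = e² + b₁ one gets α - b₁ = e² - (b₂ - α).
  ν∼ : ∀ {T} → T *P T K.∼ [ eval f b₁ -X] → ν K.∼ const e *P const e -P T *P T
  ν∼ {T} TT∼ = K.∼-trans (K.≈⇒∼ (begin
    ν                                                     ≈⟨ ν≋X-a ⟩
    X -P const b₁                                         ≈⟨ RingLemmas.sum-cancels polynomialRing (const e *P const e) (const b₁) X ⟨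
    const e *P const e -P ((const e *P const e +P const b₁) -P X) ≈⟨ +P-cong (≋-refl {const e *P const e}) (scale-cong ≡.refl
      (≋-trans (+P-cong b₂≋ (≋-refl {negP X})) (≋-sym ([-X]≋ (eval f b₁))))) ⟩
    const e *P const e -P [ eval f b₁ -X]                 ∎))
    (K.∼-+-cong (K.≈⇒∼ (≋-refl {const e *P const e})) (K.∼-neg-cong (K.∼-sym TT∼)))
    where
    open SetoidReasoning (CommutativeRing.setoid polynomialRing)
    b₂≋ : const e *P const e +P const b₁ ≋ const (eval f b₁)
    b₂≋ = ≋-trans (+P-cong (≋-sym (const-* e e)) (≋-refl {const b₁})) (∷-cong (≡.sym (eval-f b₁)) ≋-refl)

  parity : ∀ n → 1 ≤ n → (∃ λ j → n ≡ suc j ℕ.+ suc j) ⊎ (∃ λ j → n ≡ suc (j ℕ.+ j))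
  parity (suc zero)          _ = inj₂ (0 , ≡.refl)
  parity (suc (suc zero))    _ = inj₁ (0 , ≡.refl)
  parity (suc (suc (suc n))) _ with parity (suc n) (s≤s z≤n)
  ... | inj₁ (j , eq) = inj₁ (suc j , ≡.cong suc (≡.trans (≡.cong suc eq) (≡.cong suc (≡.sym (ℕ.+-suc j (suc j))))))
  ... | inj₂ (j , eq) = inj₂ (suc j , ≡.cong suc (≡.trans (≡.cong suc eq) (≡.cong suc (≡.sym (ℕ.+-suc j j)))))

  -- In the application `x` is b_n, and `x²≡` is the relation b² = - 2e coming from preperiodicity.
  module _ (x : FiniteField.Carrier F) (x²≡ : (x - γ) · (x - γ) + (1# + 1#) · e ≡ 0#)
           (b₂≢b₁ : ¬ (eval f b₁ - b₁ ≡ 0#)) (g-square : IsSquare (eval g (eval f b₁))) where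

    b : Poly
    b = const (x - γ)

    b²∼ : b *P b +P two *P const e K.∼ []
    b²∼ = K.≈⇒∼ (≋-trans (+P-cong (≋-sym (const-* (x - γ) (x - γ))) (≋-sym (const-* (1# + 1#) e))) (≋-trans (∷-cong x²≡ ≋-refl) const-0))

    -- The factor `const 1#` brings x - X into the shape (a - X) B on which Thue's argument
    -- operates.
    ψb-δ : ψ b -P δ ≋ [ x -X] *P const 1#
    ψb-δ = begin
      ψ b -P δ                                     ≈⟨ +P-cong (ψ-const (x - γ)) (≋-refl {negP δ}) ⟩
      const (x - γ) -P (X -P const γ)              ≈⟨ RingLemmas.shift-difference polynomialRing (const (x - γ)) X (const γ) ⟩
      ((const (x - γ) +P const γ) -P X) *P const 1# ≈⟨ *P-congʳ {(const (x - γ) +P const γ) -P X} {[ x -X]} (const 1#) (≋-trans (+P-cong {const (x - γ) +P const γ} {const x}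
        (∷-cong (RingLemmas.restore fieldRing x γ) ≋-refl) (≋-refl {negP X})) (≋-sym ([-X]≋ x))) ⟩
      [ x -X] *P const 1#                          ∎
      where open SetoidReasoning (CommutativeRing.setoid polynomialRing)

    from-root : ∀ T s ρ → T *P T K.∼ [ eval f b₁ -X] → s *P s K.∼ two *P (T -P const e) →
      two *P (ρ *P ρ) -P const 1# K.∼ [] → Square L.quotientRing ([ x -X] *P const 1#)
    from-root T s ρ TT∼ ss∼ ρ²∼ = RingLemmas.square-resp L.quotientRing (L.≈⇒∼ ψb-δ)
      (square-in-extension b (const e) T s ρ δ b²∼ ρ²∼ (RingLemmas.≈⇒diff≈0 K.quotientRing ss∼) (ν∼ {T} TT∼) (L.≈⇒∼ (≋-refl {β})))

    from-signed-root : ∀ T → T *P T K.∼ [ eval f b₁ -X] →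
      (∃ λ T′ → T′ *P T′ K.∼ T *P T × Square K.quotientRing (two *P (T′ -P const e))) →
      Square L.quotientRing ([ x -X] *P const 1#)
    from-signed-root T TT∼ (T′ , T′T′∼ , s , ss∼) = from-root T′ s (proj₁ half-square) (K.∼-trans T′T′∼ TT∼) ss∼ (proj₂ half-square)

    residue-square : Square K.quotientRing [ eval f b₁ -X] → Square L.quotientRing ([ x -X] *P const 1#)
    residue-square (T , TT∼) = from-signed-root T TT∼
      (SignChoice.choose-sign K.quotientRing K.zero-or-unit ν index-two T (const e) (ν∼ {T} TT∼))

    abstract
      x-X-square : Square L.quotientRing ([ x -X] *P const 1#)
      x-X-square = residue-square (linear-square (eval f b₁) b₂≢b₁ g-square)

    value-is-square : IsSquare (eval H x)
    value-is-square with parity (degree H) (proj₁ H-irreducible)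
    ... | inj₁ (j , even) = Reciprocity.linear-even F H (Monic⇒HasDegree H H-monic) H-monic j even x 1# (0≢1 ∘ ≡.sym) x-X-square
    ... | inj₂ (j , odd′) = Reciprocity.linear-odd F H (Monic⇒HasDegree H H-monic) H-monic j odd′ x x-X-square

open FiniteField using (Carrier)
open FieldDefs

theorem1p3 : ∀ {c : Level} (F : FiniteField c) → OddCharacteristic F →
    ∀ (f : Poly F) (γ : Carrier F) (n : ℕ) →
    MonicQuadratic F f → CriticalPoint F f γ → OrbitType F f γ 2 n →
    ∀ (g : Poly F) → Monic F g → Irreducible F g → (∃ λ k → degree F g ≡ 2 * k) →
    ¬ IsSquare F (eval F g (iter F f 1 γ)) → IsSquare F (eval F g (iter F f 2 γ)) →
    ∀ (H : Poly F) → Monic F H → Irreducible F H →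
    _∣P_ F H (compose F g (compose F f f)) →
    IsSquare F (eval F H (iter F f n γ))
theorem1p3 F odd f γ n f-quadratic critical (n≥1 , periodic , minimal , _) g g-monic g-irreducible (k , g-even) nonsquare square H H-monic H-irreducible H∣ =
  value k g-even
  where
  f-form = CriticalPoints.critical-form F f γ f-quadratic critical
  open Composition F f γ f-form using (preperiodic)
  value : ∀ k → degree F g ≡ 2 * k → IsSquare F (eval F H (iter F f n γ))
  value zero    eq = contradiction (≡.subst (1 ≤_) eq (proj₁ g-irreducible)) λ ()
  value (suc k) eq = FactorValue.value-is-square F odd f γ f-form g g-monic g-irreducible k
    (≡.trans eq (≡.cong (suc k ℕ.+_) (ℕ.+-identityʳ (suc k)))) nonsquare H H-monic H-irreducible H∣ (iter F f n γ)
    -- The preperiod is 2, so b₁ does not recur in the orbit; in particular b₁ differs from f(b_n).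
    (preperiodic (iter F f n γ) periodic (minimal 1 n (s≤s (s≤s z≤n)) n≥1))
    -- For the same reason b₂ differs from b₁.
    (λ e → minimal 1 1 (s≤s (s≤s z≤n)) (s≤s z≤n) (≡.sym (RingLemmas.diff≈0⇒≈ (PolynomialRing.fieldRing F) e)))
    square
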